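{- Let $d$ be a square-free rational integer with $d\equiv 1\pmod 4$ and $d\neq 1$, let $K=\mathbb{Q}(\sqrt{d})$ be the corresponding quadratic field with ring of algebraic integers $O_{K}=\mathbb{Z}\left[\frac{1+\sqrt{d}}{2}\right]$, and let $\sigma,\tau$ be two different non-zero ring endomorphisms of $O_{K}$. Let $D:O_{K}\to O_{K}$ be a $(\sigma,\tau)$-derivation with $D\left(\frac{1+\sqrt{d}}{2}\right)=c_{0}+c_{1}\left(\frac{1+\sqrt{d}}{2}\right)$, where $c_{0},c_{1}\in\mathbb{Z}$. Then $D$ is inner if and only if $d$ divides both $-c_{0}+c_{1}\left(\frac{d-1}{2}\right)$ and $2c_{0}+c_{1}$. In particular: (i) $D$ is inner if $d$ divides both $c_{0}$ and $c_{1}$; (ii) $O_{K}$ has non-trivial outer $(\sigma,\tau)$-derivations, that is, $\mathrm{Out}_{(\sigma,\tau)}(O_{K})\neq\{0\}$.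
   Context: $O_{K}$ is regarded as a commutative unital $\mathbb{Z}$-algebra. A $(\sigma,\tau)$-derivation of $O_{K}$ is a $\mathbb{Z}$-linear map $D:O_{K}\to O_{K}$ with $D(xy)=D(x)\tau(y)+\sigma(x)D(y)$ for all $x,y\in O_{K}$. It is called inner if there exists $\beta\in O_{K}$ with $D(x)=\beta\tau(x)-\sigma(x)\beta$ for all $x\in O_{K}$. $\mathrm{Out}_{(\sigma,\tau)}(O_{K})$ denotes the quotient of the $\mathbb{Z}$-module $\mathcal{D}_{(\sigma,\tau)}(O_{K})$ of all $(\sigma,\tau)$-derivations by the submodule $\mathrm{Inn}_{(\sigma,\tau)}(O_{K})$ of inner ones. -}

module Defs where

open import Algebra.Bundles using (CommutativeMonoid; CommutativeRing; Ring; RawRing)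
open import Algebra.Module.Bundles using (LeftModule)
open import Algebra.Module.Morphism.Structures using (module LeftModuleMorphisms)
open import Algebra.Morphism.Structures using (module RingWithoutOneMorphisms; IsRingHomomorphism; IsRingMonomorphism)
import Algebra.Morphism.RingMonomorphism as RingMonomorphism
import Algebra.Properties.AbelianGroup as AbelianGroupProperties
import Algebra.Properties.CommutativeSemigroup as CommutativeSemigroupProperties
import Algebra.Properties.Ring as RingProperties
import Algebra.Properties.Semiring.Exp as Exp
import Algebra.Solver.Ring as RingSolver
import Algebra.Solver.Ring.AlmostCommutativeRing as ACR
open import Data.Empty using (⊥-elim)
open import Data.Integer as ℤ using (ℤ; +_; 0ℤ; 1ℤ; -1ℤ; ∣_∣)
open import Data.Integer.Divisibility using (_∣_)
import Data.Integer.Divisibility.Signed as Signed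
import Data.Integer.Properties as ℤ
open import Data.List using (List; []; _∷_; length)
open import Data.Maybe as Maybe using (Maybe)
open import Data.Nat as ℕ using (ℕ; zero; suc; z≤n; s≤s)
open import Data.Nat.Coprimality using (Coprime; coprime-divisor; recompute)
import Data.Nat.Coprimality as ℕ
import Data.Nat.Divisibility as ℕ
import Data.Nat.Properties as ℕ
open import Data.Product using (∃-syntax; _×_; _,_; proj₁; proj₂)
open import Data.Rational as ℚ using (ℚ; 0ℚ; 1ℚ; ½; ↥_; ↧_; ↧ₙ_; mkℚ)
import Data.Rational.Properties as ℚ
import Data.Rational.Solver as ℚ
open import Data.Rational.Unnormalised as ℚᵘ using (mkℚᵘ; *≡*)
import Data.Rational.Unnormalised.Properties as ℚᵘ
open import Data.Sum using (inj₁; inj₂)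
open import Level using (Level; 0ℓ; _⊔_)
open import Relation.Nullary using (¬_; dec⇒maybe)
open import Relation.Unary using (Pred)
import Relation.Binary.Reasoning.Setoid as SetoidReasoning

record IsSubmodule {r ℓr m ℓm p} {R : Ring r ℓr} (M : LeftModule R m ℓm)
                   (P : Pred (LeftModule.Carrierᴹ M) p) : Set (r ⊔ m ⊔ ℓm ⊔ p) where
  open LeftModule M
  field
    resp : ∀ {x y} → x ≈ᴹ y → P x → P y
    0∈   : P 0ᴹ
    +∈   : ∀ {x y} → P x → P y → P (x +ᴹ y)
    -∈   : ∀ {x} → P x → P (-ᴹ x)
    *ₗ∈  : ∀ r {x} → P x → P (r *ₗ x)

quotient : ∀ {r ℓr m ℓm p} {R : Ring r ℓr} (M : LeftModule R m ℓm)
           {P : Pred (LeftModule.Carrierᴹ M) p} → IsSubmodule M P → LeftModule R m p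
quotient {R = R} M {P} isSubmodule = record
  { Carrierᴹ = Carrierᴹ
  ; _≈ᴹ_ = _∼_
  ; _+ᴹ_ = _+ᴹ_
  ; _*ₗ_ = _*ₗ_
  ; 0ᴹ = 0ᴹ
  ; -ᴹ_ = -ᴹ_
  ; isLeftModule = record
    { isLeftSemimodule = record
      { +ᴹ-isCommutativeMonoid = record
        { isMonoid = record
          { isSemigroup = record
            { isMagma = record
              { isEquivalence = record { refl = ⌊ ≈ᴹ-refl ⌋ ; sym = ∼-sym ; trans = ∼-trans }
              ; ∙-cong = ∼-+-cong
              }
            ; assoc = λ x y z → ⌊ +ᴹ-assoc x y z ⌋
            }
          ; identity = (λ x → ⌊ +ᴹ-identityˡ x ⌋) , (λ x → ⌊ +ᴹ-identityʳ x ⌋)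
          }
        ; comm = λ x y → ⌊ +ᴹ-comm x y ⌋
        }
      ; isPreleftSemimodule = record
        { *ₗ-cong = ∼-*ₗ-cong
        ; *ₗ-zeroˡ = λ x → ⌊ *ₗ-zeroˡ x ⌋
        ; *ₗ-distribʳ = λ x r s → ⌊ *ₗ-distribʳ x r s ⌋
        ; *ₗ-identityˡ = λ x → ⌊ *ₗ-identityˡ x ⌋
        ; *ₗ-assoc = λ r s x → ⌊ *ₗ-assoc r s x ⌋
        ; *ₗ-zeroʳ = λ r → ⌊ *ₗ-zeroʳ r ⌋
        ; *ₗ-distribˡ = λ r x y → ⌊ *ₗ-distribˡ r x y ⌋
        }
      }
    ; -ᴹ‿cong = ∼-neg-cong
    ; -ᴹ‿inverse = (λ x → ⌊ -ᴹ‿inverseˡ x ⌋) , (λ x → ⌊ -ᴹ‿inverseʳ x ⌋)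
    }
  }
  where
  open Ring R using (_≈_)
  open LeftModule M
  open IsSubmodule isSubmodule
  open AbelianGroupProperties +ᴹ-abelianGroup using (⁻¹-∙-comm; ⁻¹-anti-homo-//; inverseʳ-unique)
  open CommutativeSemigroupProperties (CommutativeMonoid.commutativeSemigroup +ᴹ-commutativeMonoid) using (interchange)
  open SetoidReasoning ≈ᴹ-setoid

  infix 4 _∼_

  _∼_ : Carrierᴹ → Carrierᴹ → Set _
  x ∼ y = P (x +ᴹ -ᴹ y)

  ⌊_⌋ : ∀ {x y} → x ≈ᴹ y → x ∼ y
  ⌊_⌋ {x} {y} x≈y = resp (≈ᴹ-sym (begin
    x +ᴹ -ᴹ y ≈⟨ +ᴹ-congʳ x≈y ⟩
    y +ᴹ -ᴹ y ≈⟨ -ᴹ‿inverseʳ y ⟩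
    0ᴹ        ∎)) 0∈

  ∼-sym : ∀ {x y} → x ∼ y → y ∼ x
  ∼-sym {x} {y} x∼y = resp (⁻¹-anti-homo-// x y) (-∈ x∼y)

  ∼-trans : ∀ {x y z} → x ∼ y → y ∼ z → x ∼ z
  ∼-trans {x} {y} {z} x∼y y∼z = resp (begin
    (x +ᴹ -ᴹ y) +ᴹ (y +ᴹ -ᴹ z) ≈⟨ +ᴹ-assoc x (-ᴹ y) (y +ᴹ -ᴹ z) ⟩
    x +ᴹ (-ᴹ y +ᴹ (y +ᴹ -ᴹ z)) ≈⟨ +ᴹ-congˡ (+ᴹ-assoc (-ᴹ y) y (-ᴹ z)) ⟨
    x +ᴹ ((-ᴹ y +ᴹ y) +ᴹ -ᴹ z) ≈⟨ +ᴹ-congˡ (+ᴹ-congʳ (-ᴹ‿inverseˡ y)) ⟩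
    x +ᴹ (0ᴹ +ᴹ -ᴹ z)          ≈⟨ +ᴹ-congˡ (+ᴹ-identityˡ (-ᴹ z)) ⟩
    x +ᴹ -ᴹ z                  ∎) (+∈ x∼y y∼z)

  ∼-+-cong : ∀ {x x′ y y′} → x ∼ x′ → y ∼ y′ → x +ᴹ y ∼ x′ +ᴹ y′
  ∼-+-cong {x} {x′} {y} {y′} x∼x′ y∼y′ = resp (begin
    (x +ᴹ -ᴹ x′) +ᴹ (y +ᴹ -ᴹ y′) ≈⟨ interchange x (-ᴹ x′) y (-ᴹ y′) ⟩
    (x +ᴹ y) +ᴹ (-ᴹ x′ +ᴹ -ᴹ y′) ≈⟨ +ᴹ-congˡ (⁻¹-∙-comm x′ y′) ⟩
    (x +ᴹ y) +ᴹ -ᴹ (x′ +ᴹ y′)    ∎) (+∈ x∼x′ y∼y′)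

  ∼-neg-cong : ∀ {x y} → x ∼ y → -ᴹ x ∼ -ᴹ y
  ∼-neg-cong {x} {y} x∼y = resp (≈ᴹ-sym (⁻¹-∙-comm x (-ᴹ y))) (-∈ x∼y)

  *ₗ-neg : ∀ r x → r *ₗ (-ᴹ x) ≈ᴹ -ᴹ (r *ₗ x)
  *ₗ-neg r x = inverseʳ-unique (r *ₗ x) (r *ₗ (-ᴹ x)) (begin
    r *ₗ x +ᴹ r *ₗ (-ᴹ x) ≈⟨ *ₗ-distribˡ r x (-ᴹ x) ⟨
    r *ₗ (x +ᴹ -ᴹ x)      ≈⟨ *ₗ-congˡ (-ᴹ‿inverseʳ x) ⟩
    r *ₗ 0ᴹ               ≈⟨ *ₗ-zeroʳ r ⟩
    0ᴹ                    ∎)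

  ∼-*ₗ-cong : ∀ {r s x y} → r ≈ s → x ∼ y → r *ₗ x ∼ s *ₗ y
  ∼-*ₗ-cong {r} {s} {x} {y} r≈s x∼y = resp (begin
    r *ₗ (x +ᴹ -ᴹ y)        ≈⟨ *ₗ-distribˡ r x (-ᴹ y) ⟩
    r *ₗ x +ᴹ r *ₗ (-ᴹ y)   ≈⟨ +ᴹ-congˡ (*ₗ-neg r y) ⟩
    r *ₗ x +ᴹ -ᴹ (r *ₗ y)   ≈⟨ +ᴹ-congˡ (-ᴹ‿cong (*ₗ-congʳ r≈s)) ⟩
    r *ₗ x +ᴹ -ᴹ (s *ₗ y)   ∎) (*ₗ∈ r x∼y)

NonTrivial : ∀ {r ℓr m ℓm} {R : Ring r ℓr} → LeftModule R m ℓm → Set (m ⊔ ℓm)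
NonTrivial M = ∃[ x ] ¬ x ≈ᴹ 0ᴹ
  where open LeftModule M

-- A is an R-algebra through the ring homomorphism η : R → A.
module TwistedDerivations
  {r ℓr a ℓa : Level} (R : CommutativeRing r ℓr) (A : CommutativeRing a ℓa)
  (η : CommutativeRing.Carrier R → CommutativeRing.Carrier A)
  (η-isRingHomomorphism :
    IsRingHomomorphism (CommutativeRing.rawRing R) (CommutativeRing.rawRing A) η)
  where

  private
    module R = CommutativeRing R
    module η = IsRingHomomorphism η-isRingHomomorphism

  open CommutativeRing A
  open RingProperties ring using (-‿distribˡ-*; -‿distribʳ-*; -0#≈0#)
  open AbelianGroupProperties +-abelianGroup using (⁻¹-∙-comm)
  open CommutativeSemigroupProperties +-commutativeSemigroup using (interchange)
  open CommutativeSemigroupProperties *-commutativeSemigroup using (x∙yz≈y∙xz)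
  open SetoidReasoning setoid

  algebraModule : LeftModule R.ring a ℓa
  algebraModule = record
    { Carrierᴹ = Carrier ; _≈ᴹ_ = _≈_ ; _+ᴹ_ = _+_ ; _*ₗ_ = λ r x → η r * x ; 0ᴹ = 0# ; -ᴹ_ = -_
    ; isLeftModule = record
      { isLeftSemimodule = record
        { +ᴹ-isCommutativeMonoid = +-isCommutativeMonoid
        ; isPreleftSemimodule = record
          { *ₗ-cong = λ r≈s x≈y → *-cong (η.⟦⟧-cong r≈s) x≈y
          ; *ₗ-zeroˡ = λ x → trans (*-congʳ η.0#-homo) (zeroˡ x)
          ; *ₗ-distribʳ = λ x r s → trans (*-congʳ (η.+-homo r s)) (distribʳ x (η r) (η s))
          ; *ₗ-identityˡ = λ x → trans (*-congʳ η.1#-homo) (*-identityˡ x)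
          ; *ₗ-assoc = λ r s x → trans (*-congʳ (η.*-homo r s)) (*-assoc (η r) (η s) x)
          ; *ₗ-zeroʳ = λ r → zeroʳ (η r)
          ; *ₗ-distribˡ = λ r x y → distribˡ (η r) x y
          }
        }
      ; -ᴹ‿cong = -‿cong
      ; -ᴹ‿inverse = -‿inverse
      }
    }

  open LeftModule algebraModule using (rawLeftModule)
  open LeftModuleMorphisms rawLeftModule rawLeftModule using (IsLeftModuleHomomorphism)

  record Derivation (σ τ : Carrier → Carrier) : Set (r ⊔ a ⊔ ℓa) where
    field
      ⟦_⟧      : Carrier → Carrier
      isLinear : IsLeftModuleHomomorphism ⟦_⟧
      leibniz  : ∀ x y → ⟦ x * y ⟧ ≈ ⟦ x ⟧ * τ y + σ x * ⟦ y ⟧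

    open IsLeftModuleHomomorphism isLinear public
      using (⟦⟧-cong; *ₗ-homo)
      renaming (+ᴹ-homo to +-homo; 0ᴹ-homo to 0#-homo; -ᴹ-homo to -‿homo)

  IsInner : ∀ {σ τ} → Derivation σ τ → Set (a ⊔ ℓa)
  IsInner {σ} {τ} D = ∃[ β ] ∀ x → ⟦ x ⟧ ≈ β * τ x - σ x * β
    where open Derivation D

  module _ (σ τ : Carrier → Carrier) where

    open Derivation

    private
      isLinear′ : ∀ {f : Carrier → Carrier} → (∀ {x y} → x ≈ y → f x ≈ f y) →
                  (∀ x y → f (x + y) ≈ f x + f y) → f 0# ≈ 0# → (∀ x → f (- x) ≈ - f x) →
                  (∀ r x → f (η r * x) ≈ η r * f x) → IsLeftModuleHomomorphism f
      isLinear′ f-cong f-+ f-0 f-neg f-scale = record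
        { +ᴹ-isGroupHomomorphism = record
          { isMonoidHomomorphism = record
            { isMagmaHomomorphism = record
              { isRelHomomorphism = record { cong = f-cong }
              ; homo = f-+
              }
            ; ε-homo = f-0
            }
          ; ⁻¹-homo = f-neg
          }
        ; *ₗ-homo = f-scale
        }

      _⊕_ : Derivation σ τ → Derivation σ τ → Derivation σ τ
      D ⊕ E = record
        { ⟦_⟧ = λ x → ⟦ D ⟧ x + ⟦ E ⟧ x
        ; isLinear = isLinear′
            (λ x≈y → +-cong (⟦⟧-cong D x≈y) (⟦⟧-cong E x≈y))
            (λ x y → trans (+-cong (+-homo D x y) (+-homo E x y)) (interchange _ _ _ _))
            (trans (+-cong (0#-homo D) (0#-homo E)) (+-identityˡ 0#))
            (λ x → trans (+-cong (-‿homo D x) (-‿homo E x)) (⁻¹-∙-comm _ _))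
            (λ r x → trans (+-cong (*ₗ-homo D r x) (*ₗ-homo E r x)) (sym (distribˡ (η r) _ _)))
        ; leibniz = λ x y → begin
            ⟦ D ⟧ (x * y) + ⟦ E ⟧ (x * y)
              ≈⟨ +-cong (leibniz D x y) (leibniz E x y) ⟩
            (⟦ D ⟧ x * τ y + σ x * ⟦ D ⟧ y) + (⟦ E ⟧ x * τ y + σ x * ⟦ E ⟧ y)
              ≈⟨ interchange _ _ _ _ ⟩
            (⟦ D ⟧ x * τ y + ⟦ E ⟧ x * τ y) + (σ x * ⟦ D ⟧ y + σ x * ⟦ E ⟧ y)
              ≈⟨ +-cong (distribʳ (τ y) _ _) (distribˡ (σ x) _ _) ⟨
            (⟦ D ⟧ x + ⟦ E ⟧ x) * τ y + σ x * (⟦ D ⟧ y + ⟦ E ⟧ y) ∎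
        }

      ⊖_ : Derivation σ τ → Derivation σ τ
      ⊖ D = record
        { ⟦_⟧ = λ x → - ⟦ D ⟧ x
        ; isLinear = isLinear′
            (λ x≈y → -‿cong (⟦⟧-cong D x≈y))
            (λ x y → trans (-‿cong (+-homo D x y)) (sym (⁻¹-∙-comm _ _)))
            (trans (-‿cong (0#-homo D)) -0#≈0#)
            (λ x → -‿cong (-‿homo D x))
            (λ r x → trans (-‿cong (*ₗ-homo D r x)) (-‿distribʳ-* (η r) _))
        ; leibniz = λ x y → begin
            - ⟦ D ⟧ (x * y)                           ≈⟨ -‿cong (leibniz D x y) ⟩
            - (⟦ D ⟧ x * τ y + σ x * ⟦ D ⟧ y)         ≈⟨ ⁻¹-∙-comm _ _ ⟨
            - (⟦ D ⟧ x * τ y) + - (σ x * ⟦ D ⟧ y)     ≈⟨ +-cong (-‿distribˡ-* _ _) (-‿distribʳ-* _ _) ⟩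
            - ⟦ D ⟧ x * τ y + σ x * - ⟦ D ⟧ y         ∎
        }

      _•_ : R.Carrier → Derivation σ τ → Derivation σ τ
      s • D = record
        { ⟦_⟧ = λ x → η s * ⟦ D ⟧ x
        ; isLinear = isLinear′
            (λ x≈y → *-congˡ (⟦⟧-cong D x≈y))
            (λ x y → trans (*-congˡ (+-homo D x y)) (distribˡ (η s) _ _))
            (trans (*-congˡ (0#-homo D)) (zeroʳ (η s)))
            (λ x → trans (*-congˡ (-‿homo D x)) (sym (-‿distribʳ-* (η s) _)))
            (λ r x → trans (*-congˡ (*ₗ-homo D r x)) (x∙yz≈y∙xz (η s) (η r) _))
        ; leibniz = λ x y → begin
            η s * ⟦ D ⟧ (x * y)                              ≈⟨ *-congˡ (leibniz D x y) ⟩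
            η s * (⟦ D ⟧ x * τ y + σ x * ⟦ D ⟧ y)            ≈⟨ distribˡ (η s) _ _ ⟩
            η s * (⟦ D ⟧ x * τ y) + η s * (σ x * ⟦ D ⟧ y)    ≈⟨ +-cong (sym (*-assoc (η s) _ _)) (x∙yz≈y∙xz (η s) (σ x) _) ⟩
            (η s * ⟦ D ⟧ x) * τ y + σ x * (η s * ⟦ D ⟧ y)    ∎
        }

      𝟘 : Derivation σ τ
      𝟘 = record
        { ⟦_⟧ = λ x → 0#
        ; isLinear = isLinear′ (λ _ → refl) (λ _ _ → sym (+-identityˡ 0#)) refl
            (λ _ → sym -0#≈0#) (λ r _ → sym (zeroʳ (η r)))
        ; leibniz = λ x y → sym (trans (+-cong (zeroˡ (τ y)) (zeroʳ (σ x))) (+-identityˡ 0#))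
        }

    Der : LeftModule R.ring (r ⊔ a ⊔ ℓa) (a ⊔ ℓa)
    Der = record
      { Carrierᴹ = Derivation σ τ
      ; _≈ᴹ_ = λ D E → ∀ x → ⟦ D ⟧ x ≈ ⟦ E ⟧ x
      ; _+ᴹ_ = _⊕_
      ; _*ₗ_ = _•_
      ; 0ᴹ = 𝟘
      ; -ᴹ_ = ⊖_
      ; isLeftModule = record
        { isLeftSemimodule = record
          { +ᴹ-isCommutativeMonoid = record
            { isMonoid = record
              { isSemigroup = record
                { isMagma = record
                  { isEquivalence = record
                    { refl = λ _ → refl
                    ; sym = λ D≈E x → sym (D≈E x)
                    ; trans = λ D≈E E≈F x → trans (D≈E x) (E≈F x)
                    }
                  ; ∙-cong = λ D≈D′ E≈E′ x → +-cong (D≈D′ x) (E≈E′ x)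
                  }
                ; assoc = λ D E F x → +-assoc _ _ _
                }
              ; identity = (λ D x → +-identityˡ _) , (λ D x → +-identityʳ _)
              }
            ; comm = λ D E x → +-comm _ _
            }
          ; isPreleftSemimodule = record
            { *ₗ-cong = λ r≈s D≈E x → *ₗ-cong r≈s (D≈E x)
            ; *ₗ-zeroˡ = λ D x → *ₗ-zeroˡ _
            ; *ₗ-distribʳ = λ D r s x → *ₗ-distribʳ _ r s
            ; *ₗ-identityˡ = λ D x → *ₗ-identityˡ _
            ; *ₗ-assoc = λ r s D x → *ₗ-assoc r s _
            ; *ₗ-zeroʳ = λ r x → *ₗ-zeroʳ r
            ; *ₗ-distribˡ = λ r D E x → *ₗ-distribˡ r _ _
            }
          }
        ; -ᴹ‿cong = λ D≈E x → -‿cong (D≈E x)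
        ; -ᴹ‿inverse = (λ D x → -‿inverseˡ _) , (λ D x → -‿inverseʳ _)
        }
      }
      where open LeftModule algebraModule
              using (*ₗ-cong; *ₗ-zeroˡ; *ₗ-distribʳ; *ₗ-identityˡ; *ₗ-assoc; *ₗ-zeroʳ; *ₗ-distribˡ)

    Inn : IsSubmodule Der IsInner
    Inn = record
      { resp = λ D≈E (β , inner) → β , λ x → trans (sym (D≈E x)) (inner x)
      ; 0∈ = 0# , λ x → begin
          0#                        ≈⟨ -‿inverseʳ 0# ⟨
          0# - 0#                   ≈⟨ +-cong (zeroˡ (τ x)) (-‿cong (zeroʳ (σ x))) ⟨
          0# * τ x - σ x * 0#       ∎
      ; +∈ = λ {D} {E} (β , D-inner) (γ , E-inner) → β + γ , λ x → begin
          ⟦ D ⟧ x + ⟦ E ⟧ x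
            ≈⟨ +-cong (D-inner x) (E-inner x) ⟩
          (β * τ x - σ x * β) + (γ * τ x - σ x * γ)
            ≈⟨ interchange _ _ _ _ ⟩
          (β * τ x + γ * τ x) + (- (σ x * β) - σ x * γ)
            ≈⟨ +-cong (sym (distribʳ (τ x) β γ)) (trans (⁻¹-∙-comm _ _) (-‿cong (sym (distribˡ (σ x) β γ)))) ⟩
          (β + γ) * τ x - σ x * (β + γ) ∎
      ; -∈ = λ {D} (β , inner) → - β , λ x → begin
          - ⟦ D ⟧ x                      ≈⟨ -‿cong (inner x) ⟩
          - (β * τ x - σ x * β)          ≈⟨ ⁻¹-∙-comm _ _ ⟨
          - (β * τ x) - - (σ x * β)      ≈⟨ +-cong (-‿distribˡ-* β (τ x)) (-‿cong (-‿distribʳ-* (σ x) β)) ⟩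
          - β * τ x - σ x * - β          ∎
      ; *ₗ∈ = λ s {D} (β , inner) → η s * β , λ x → begin
          η s * ⟦ D ⟧ x                              ≈⟨ *-congˡ (inner x) ⟩
          η s * (β * τ x - σ x * β)                  ≈⟨ distribˡ (η s) _ _ ⟩
          η s * (β * τ x) + η s * - (σ x * β)
            ≈⟨ +-cong (sym (*-assoc (η s) β (τ x)))
                      (trans (sym (-‿distribʳ-* (η s) _)) (-‿cong (x∙yz≈y∙xz (η s) (σ x) β))) ⟩
          (η s * β) * τ x - σ x * (η s * β)          ∎
      }

    Out : LeftModule R.ring (r ⊔ a ⊔ ℓa) (a ⊔ ℓa)
    Out = quotient Der Inn

open import Relation.Binary.PropositionalEquality
  using (_≡_; _≢_; refl; sym; trans; cong; cong₂; subst; isEquivalence; isMagma; module ≡-Reasoning)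

SquareFree : ℤ → Set
SquareFree d = ∀ n → n ℤ.* n ∣ d → ∣ n ∣ ≡ 1

ι : ℤ → ℚ
ι n = n ℚ./ 1

Integral-ℚ : ℚ → Set
Integral-ℚ q = ∃[ n ] q ≡ ι n

ℚ-ring : CommutativeRing 0ℓ 0ℓ
ℚ-ring = ℚ.+-*-commutativeRing

module ℚ^ = Exp (CommutativeRing.semiring ℚ-ring)

toℚᵘ-ι : ∀ n → ℚ.toℚᵘ (ι n) ℚᵘ.≃ mkℚᵘ n 0
toℚᵘ-ι n = ℚ.toℚᵘ-fromℚᵘ (mkℚᵘ n 0)

ι-+ : ∀ m n → ι (m ℤ.+ n) ≡ ι m ℚ.+ ι n
ι-+ m n = ℚ.toℚᵘ-injective (begin
  ℚ.toℚᵘ (ι (m ℤ.+ n))             ≈⟨ toℚᵘ-ι (m ℤ.+ n) ⟩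
  mkℚᵘ (m ℤ.+ n) 0                 ≈⟨ *≡* (cong₂ (λ a b → (a ℤ.+ b) ℤ.* 1ℤ)
                                        (sym (ℤ.*-identityʳ m)) (sym (ℤ.*-identityʳ n))) ⟩
  mkℚᵘ m 0 ℚᵘ.+ mkℚᵘ n 0           ≈⟨ ℚᵘ.+-cong (toℚᵘ-ι m) (toℚᵘ-ι n) ⟨
  ℚ.toℚᵘ (ι m) ℚᵘ.+ ℚ.toℚᵘ (ι n)   ≈⟨ ℚ.toℚᵘ-homo-+ (ι m) (ι n) ⟨
  ℚ.toℚᵘ (ι m ℚ.+ ι n)             ∎)
  where open ℚᵘ.≃-Reasoning

ι-* : ∀ m n → ι (m ℤ.* n) ≡ ι m ℚ.* ι n
ι-* m n = ℚ.toℚᵘ-injective (begin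
  ℚ.toℚᵘ (ι (m ℤ.* n))             ≈⟨ toℚᵘ-ι (m ℤ.* n) ⟩
  mkℚᵘ m 0 ℚᵘ.* mkℚᵘ n 0           ≈⟨ ℚᵘ.*-cong (toℚᵘ-ι m) (toℚᵘ-ι n) ⟨
  ℚ.toℚᵘ (ι m) ℚᵘ.* ℚ.toℚᵘ (ι n)   ≈⟨ ℚ.toℚᵘ-homo-* (ι m) (ι n) ⟨
  ℚ.toℚᵘ (ι m ℚ.* ι n)             ∎)
  where open ℚᵘ.≃-Reasoning

ι-neg : ∀ n → ι (ℤ.- n) ≡ ℚ.- ι n
ι-neg n = ℚ.toℚᵘ-injective (begin
  ℚ.toℚᵘ (ι (ℤ.- n))    ≈⟨ toℚᵘ-ι (ℤ.- n) ⟩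
  ℚᵘ.- mkℚᵘ n 0         ≈⟨ ℚᵘ.-‿cong (toℚᵘ-ι n) ⟨
  ℚᵘ.- ℚ.toℚᵘ (ι n)     ≈⟨ ℚ.toℚᵘ-homo‿- (ι n) ⟨
  ℚ.toℚᵘ (ℚ.- ι n)      ∎)
  where open ℚᵘ.≃-Reasoning

ι-injective : ∀ {m n} → ι m ≡ ι n → m ≡ n
ι-injective {m} {n} eq = trans (sym (ℤ.*-identityʳ m)) (trans (ℚᵘ.drop-*≡* (begin
  mkℚᵘ m 0       ≈⟨ toℚᵘ-ι m ⟨
  ℚ.toℚᵘ (ι m)   ≡⟨ cong ℚ.toℚᵘ eq ⟩
  ℚ.toℚᵘ (ι n)   ≈⟨ toℚᵘ-ι n ⟩
  mkℚᵘ n 0       ∎)) (ℤ.*-identityʳ n))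
  where open ℚᵘ.≃-Reasoning

ι-^ : ∀ n k → ι (n ℤ.^ k) ≡ ι n ℚ^.^ k
ι-^ n zero    = refl
ι-^ n (suc k) = trans (ι-* n (n ℤ.^ k)) (cong (ι n ℚ.*_) (ι-^ n k))

q*↧q : ∀ q → q ℚ.* ι (↧ q) ≡ ι (↥ q)
q*↧q q@(mkℚ n d-1 _) = ℚ.toℚᵘ-injective (begin
  ℚ.toℚᵘ (q ℚ.* ι (↧ q))             ≈⟨ ℚ.toℚᵘ-homo-* q (ι (↧ q)) ⟩
  ℚ.toℚᵘ q ℚᵘ.* ℚ.toℚᵘ (ι (↧ q))     ≈⟨ ℚᵘ.*-congˡ {ℚ.toℚᵘ q} (toℚᵘ-ι (↧ q)) ⟩
  mkℚᵘ n d-1 ℚᵘ.* mkℚᵘ (↧ q) 0       ≈⟨ *≡* (trans (ℤ.*-identityʳ _) (cong (λ k → n ℤ.* + suc k) (sym (ℕ.*-identityʳ d-1)))) ⟩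
  mkℚᵘ n 0                           ≈⟨ toℚᵘ-ι n ⟨
  ℚ.toℚᵘ (ι n)                       ∎)
  where open ℚᵘ.≃-Reasoning

↧≡1⇒integral : ∀ q → ↧ₙ q ≡ 1 → Integral-ℚ q
↧≡1⇒integral q eq = ↥ q , (begin
  q                  ≡⟨ ℚ.*-identityʳ q ⟨
  q ℚ.* ι 1ℤ         ≡⟨ cong (λ k → q ℚ.* ι (+ k)) eq ⟨
  q ℚ.* ι (↧ q)      ≡⟨ q*↧q q ⟩
  ι (↥ q)            ∎)
  where open ≡-Reasoning

integral-+ : ∀ {p q} → Integral-ℚ p → Integral-ℚ q → Integral-ℚ (p ℚ.+ q)
integral-+ (m , p≡) (n , q≡) = m ℤ.+ n , trans (cong₂ ℚ._+_ p≡ q≡) (sym (ι-+ m n))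

integral-* : ∀ {p q} → Integral-ℚ p → Integral-ℚ q → Integral-ℚ (p ℚ.* q)
integral-* (m , p≡) (n , q≡) = m ℤ.* n , trans (cong₂ ℚ._*_ p≡ q≡) (sym (ι-* m n))

integral-neg : ∀ {q} → Integral-ℚ q → Integral-ℚ (ℚ.- q)
integral-neg (n , q≡) = ℤ.- n , trans (cong ℚ.-_ q≡) (sym (ι-neg n))

coprime-* : ∀ {m n k} → Coprime m k → Coprime n k → Coprime (m ℕ.* n) k
coprime-* {m} {n} {k} m⊥k n⊥k {i} (i∣mn , i∣k) =
  n⊥k (coprime-divisor i⊥m i∣mn , i∣k)
  where
  i⊥m : Coprime i m
  i⊥m (j∣i , j∣m) = m⊥k (j∣m , ℕ.∣-trans j∣i i∣k)

coprime-^ : ∀ {m n} k → Coprime m n → Coprime (m ℕ.^ k) n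
coprime-^ zero    m⊥n (i∣1 , _) = ℕ.∣1⇒≡1 i∣1
coprime-^ (suc k) m⊥n = coprime-* m⊥n (coprime-^ k m⊥n)

n<2^n : ∀ n → n ℕ.< 2 ℕ.^ n
n<2^n zero    = s≤s z≤n
n<2^n (suc n) = ℕ.+-mono-≤ (ℕ.m^n>0 2 n)
                  (subst (suc n ℕ.≤_) (sym (ℕ.+-identityʳ (2 ℕ.^ n))) (n<2^n n))

abs-^ : ∀ n k → ∣ n ℤ.^ k ∣ ≡ ∣ n ∣ ℕ.^ k
abs-^ n zero    = refl
abs-^ n (suc k) = trans (ℤ.abs-* n (n ℤ.^ k)) (cong (∣ n ∣ ℕ.*_) (abs-^ n k))

powers-bounded⇒1 : ∀ e M → M ≢ 0 → e ≢ 0 → (∀ k → e ℕ.^ k ℕ.∣ M) → e ≡ 1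
powers-bounded⇒1 zero          M M≢0 e≢0 e^∣M = ⊥-elim (e≢0 refl)
powers-bounded⇒1 (suc zero)    M M≢0 e≢0 e^∣M = refl
powers-bounded⇒1 e@(suc (suc _)) M M≢0 e≢0 e^∣M =
  ⊥-elim (ℕ.<-irrefl refl (ℕ.<-≤-trans M<e^M (ℕ.∣⇒≤ (e^∣M M))))
  where
  instance
    M-nonZero : ℕ.NonZero M
    M-nonZero = ℕ.≢-nonZero M≢0
  M<e^M : M ℕ.< e ℕ.^ M
  M<e^M = ℕ.<-≤-trans (n<2^n M) (ℕ.^-monoˡ-≤ M (s≤s (s≤s z≤n)))

↧≢0 : ∀ q → ↧ q ≢ 0ℤ
↧≢0 (mkℚ _ _ _) ()

↥⊥↧ : ∀ q → Coprime ∣ ↥ q ∣ (↧ₙ q)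
↥⊥↧ (mkℚ _ _ c) = recompute c

-- A rational number all of whose powers have a common denominator is integral.
almostIntegral⇒integral : ∀ q N → N ≢ 0ℤ →
  (∀ k → Integral-ℚ (ι N ℚ.* q ℚ^.^ k)) → Integral-ℚ q
almostIntegral⇒integral q N N≢0 Nq^ =
  ↧≡1⇒integral q (powers-bounded⇒1 e ∣ N ∣ (λ ∣N∣≡0 → N≢0 (ℤ.∣i∣≡0⇒i≡0 ∣N∣≡0)) (λ e≡0 → ↧≢0 q (cong +_ e≡0)) e^∣N)
  where
  open ≡-Reasoning
  e = ↧ₙ q

  q^ : ∀ k → q ℚ^.^ k ℚ.* ι (↧ q) ℚ^.^ k ≡ ι (↥ q) ℚ^.^ k
  q^ zero    = refl
  q^ (suc k) = begin
    (q ℚ.* q ℚ^.^ k) ℚ.* (ι (↧ q) ℚ.* ι (↧ q) ℚ^.^ k)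
      ≡⟨ solve 4 (λ a b c e → (a :* b) :* (c :* e) := (a :* c) :* (b :* e)) refl q _ (ι (↧ q)) _ ⟩
    (q ℚ.* ι (↧ q)) ℚ.* (q ℚ^.^ k ℚ.* ι (↧ q) ℚ^.^ k)
      ≡⟨ cong₂ ℚ._*_ (q*↧q q) (q^ k) ⟩
    ι (↥ q) ℚ.* ι (↥ q) ℚ^.^ k ∎
    where open ℚ.+-*-Solver

  N*p^ : ∀ k → N ℤ.* (↥ q) ℤ.^ k ≡ proj₁ (Nq^ k) ℤ.* (↧ q) ℤ.^ k
  N*p^ k = ι-injective (begin
    ι (N ℤ.* (↥ q) ℤ.^ k)                     ≡⟨ ι-* N _ ⟩
    ι N ℚ.* ι ((↥ q) ℤ.^ k)                   ≡⟨ cong (ι N ℚ.*_) (ι-^ (↥ q) k) ⟩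
    ι N ℚ.* ι (↥ q) ℚ^.^ k                    ≡⟨ cong (ι N ℚ.*_) (q^ k) ⟨
    ι N ℚ.* (q ℚ^.^ k ℚ.* ι (↧ q) ℚ^.^ k)     ≡⟨ ℚ.*-assoc (ι N) _ _ ⟨
    ι N ℚ.* q ℚ^.^ k ℚ.* ι (↧ q) ℚ^.^ k       ≡⟨ cong₂ ℚ._*_ (proj₂ (Nq^ k)) (sym (ι-^ (↧ q) k)) ⟩
    ι (proj₁ (Nq^ k)) ℚ.* ι ((↧ q) ℤ.^ k)     ≡⟨ ι-* (proj₁ (Nq^ k)) _ ⟨
    ι (proj₁ (Nq^ k) ℤ.* (↧ q) ℤ.^ k)         ∎)

  e^∣N : ∀ k → e ℕ.^ k ℕ.∣ ∣ N ∣
  e^∣N k = coprime-divisor {n = ∣ ↥ q ∣ ℕ.^ k}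
    (coprime-^ k (ℕ.sym (coprime-^ k (↥⊥↧ q))))
    (ℕ.divides ∣ proj₁ (Nq^ k) ∣ (begin
      ∣ ↥ q ∣ ℕ.^ k ℕ.* ∣ N ∣                     ≡⟨ ℕ.*-comm (∣ ↥ q ∣ ℕ.^ k) ∣ N ∣ ⟩
      ∣ N ∣ ℕ.* ∣ ↥ q ∣ ℕ.^ k                     ≡⟨ cong (∣ N ∣ ℕ.*_) (abs-^ (↥ q) k) ⟨
      ∣ N ∣ ℕ.* ∣ (↥ q) ℤ.^ k ∣                   ≡⟨ ℤ.abs-* N _ ⟨
      ∣ N ℤ.* (↥ q) ℤ.^ k ∣                       ≡⟨ cong ∣_∣ (N*p^ k) ⟩
      ∣ proj₁ (Nq^ k) ℤ.* (↧ q) ℤ.^ k ∣           ≡⟨ ℤ.abs-* (proj₁ (Nq^ k)) _ ⟩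
      ∣ proj₁ (Nq^ k) ∣ ℕ.* ∣ (↧ q) ℤ.^ k ∣       ≡⟨ cong (∣ proj₁ (Nq^ k) ∣ ℕ.*_) (abs-^ (↧ q) k) ⟩
      ∣ proj₁ (Nq^ k) ∣ ℕ.* e ℕ.^ k               ∎))

module QuadraticField (d : ℤ) where

  -- ⟨ a , b ⟩ is a + b√d, so K is ℚ[X]/(X² - d): the field ℚ(√d) whenever d is
  -- not a square, in particular for every square-free d ≠ 1.
  record K : Set where
    constructor ⟨_,_⟩
    field
      re im : ℚ

  open K public

  infixl 7 _*_
  infixl 6 _+_
  infix  8 -_

  _+_ _*_ : K → K → K
  ⟨ a , b ⟩ + ⟨ a′ , b′ ⟩ = ⟨ a ℚ.+ a′ , b ℚ.+ b′ ⟩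
  ⟨ a , b ⟩ * ⟨ a′ , b′ ⟩ = ⟨ a ℚ.* a′ ℚ.+ ι d ℚ.* (b ℚ.* b′) , a ℚ.* b′ ℚ.+ b ℚ.* a′ ⟩

  -_ : K → K
  - ⟨ a , b ⟩ = ⟨ ℚ.- a , ℚ.- b ⟩

  0K 1K : K
  0K = ⟨ 0ℚ , 0ℚ ⟩
  1K = ⟨ 1ℚ , 0ℚ ⟩

  fromℤ : ℤ → K
  fromℤ n = ⟨ ι n , 0ℚ ⟩

  K-commutativeRing : CommutativeRing 0ℓ 0ℓ
  K-commutativeRing = record
    { Carrier = K ; _≈_ = _≡_ ; _+_ = _+_ ; _*_ = _*_ ; -_ = -_ ; 0# = 0K ; 1# = 1K
    ; isCommutativeRing = record
      { isRing = record
        { +-isAbelianGroup = record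
          { isGroup = record
            { isMonoid = record
              { isSemigroup = record
                { isMagma = isMagma _+_
                ; assoc = λ x y z → cong₂ ⟨_,_⟩ (ℚ.+-assoc (re x) (re y) (re z)) (ℚ.+-assoc (im x) (im y) (im z))
                }
              ; identity = (λ x → cong₂ ⟨_,_⟩ (ℚ.+-identityˡ (re x)) (ℚ.+-identityˡ (im x)))
                         , (λ x → cong₂ ⟨_,_⟩ (ℚ.+-identityʳ (re x)) (ℚ.+-identityʳ (im x)))
              }
            ; inverse = (λ x → cong₂ ⟨_,_⟩ (ℚ.+-inverseˡ (re x)) (ℚ.+-inverseˡ (im x)))
                      , (λ x → cong₂ ⟨_,_⟩ (ℚ.+-inverseʳ (re x)) (ℚ.+-inverseʳ (im x)))
            ; ⁻¹-cong = cong -_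
            }
          ; comm = λ x y → cong₂ ⟨_,_⟩ (ℚ.+-comm (re x) (re y)) (ℚ.+-comm (im x) (im y))
          }
        ; *-cong = cong₂ _*_
        ; *-assoc = *-assoc
        ; *-identity = *-identityˡ , (λ x → trans (*-comm x 1K) (*-identityˡ x))
        ; distrib = *-distribˡ-+ , (λ x y z → trans (*-comm (y + z) x)
            (trans (*-distribˡ-+ x y z) (cong₂ _+_ (*-comm x y) (*-comm x z))))
        }
      ; *-comm = *-comm
      }
    }
    where
    open ℚ.+-*-Solver

    *-comm : ∀ x y → x * y ≡ y * x
    *-comm ⟨ a , b ⟩ ⟨ a′ , b′ ⟩ = cong₂ ⟨_,_⟩
      (solve 5 (λ δ a b a′ b′ → a :* a′ :+ δ :* (b :* b′) := a′ :* a :+ δ :* (b′ :* b)) refl (ι d) a b a′ b′)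
      (solve 4 (λ a b a′ b′ → a :* b′ :+ b :* a′ := a′ :* b :+ b′ :* a) refl a b a′ b′)

    *-identityˡ : ∀ x → 1K * x ≡ x
    *-identityˡ ⟨ a , b ⟩ = cong₂ ⟨_,_⟩
      (solve 3 (λ δ a b → con 1ℚ :* a :+ δ :* (con 0ℚ :* b) := a) refl (ι d) a b)
      (solve 2 (λ a b → con 1ℚ :* b :+ con 0ℚ :* a := b) refl a b)

    *-assoc : ∀ x y z → (x * y) * z ≡ x * (y * z)
    *-assoc ⟨ a , b ⟩ ⟨ a′ , b′ ⟩ ⟨ a″ , b″ ⟩ = cong₂ ⟨_,_⟩
      (solve 7 (λ δ a b a′ b′ a″ b″ →
          (a :* a′ :+ δ :* (b :* b′)) :* a″ :+ δ :* ((a :* b′ :+ b :* a′) :* b″)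
        := a :* (a′ :* a″ :+ δ :* (b′ :* b″)) :+ δ :* (b :* (a′ :* b″ :+ b′ :* a″)))
        refl (ι d) a b a′ b′ a″ b″)
      (solve 7 (λ δ a b a′ b′ a″ b″ →
          (a :* a′ :+ δ :* (b :* b′)) :* b″ :+ (a :* b′ :+ b :* a′) :* a″
        := a :* (a′ :* b″ :+ b′ :* a″) :+ b :* (a′ :* a″ :+ δ :* (b′ :* b″)))
        refl (ι d) a b a′ b′ a″ b″)

    *-distribˡ-+ : ∀ x y z → x * (y + z) ≡ x * y + x * z
    *-distribˡ-+ ⟨ a , b ⟩ ⟨ a′ , b′ ⟩ ⟨ a″ , b″ ⟩ = cong₂ ⟨_,_⟩
      (solve 7 (λ δ a b a′ b′ a″ b″ →
          a :* (a′ :+ a″) :+ δ :* (b :* (b′ :+ b″))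
        := (a :* a′ :+ δ :* (b :* b′)) :+ (a :* a″ :+ δ :* (b :* b″)))
        refl (ι d) a b a′ b′ a″ b″)
      (solve 6 (λ a b a′ b′ a″ b″ →
          a :* (b′ :+ b″) :+ b :* (a′ :+ a″)
        := (a :* b′ :+ b :* a′) :+ (a :* b″ :+ b :* a″))
        refl a b a′ b′ a″ b″)

  -- The value at x of the monic polynomial cs₀ + cs₁X + ⋯ + csₙ₋₁Xⁿ⁻¹ + Xⁿ,
  -- n = length cs, in Horner form.
  monic : List ℤ → K → K
  monic []       x = 1K
  monic (c ∷ cs) x = fromℤ c + x * monic cs x

  IsAlgebraicInteger : K → Set
  IsAlgebraicInteger x = ∃[ cs ] monic cs x ≡ 0K

  module 𝕂 = CommutativeRing K-commutativeRing
  module K^ = Exp 𝕂.semiring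

  fromℤ-+ : ∀ m n → fromℤ (m ℤ.+ n) ≡ fromℤ m + fromℤ n
  fromℤ-+ m n = cong₂ ⟨_,_⟩ (ι-+ m n) refl

  fromℤ-* : ∀ m n → fromℤ (m ℤ.* n) ≡ fromℤ m * fromℤ n
  fromℤ-* m n = cong₂ ⟨_,_⟩
    (trans (ι-* m n) (solve 3 (λ δ a b → a :* b := a :* b :+ δ :* (con 0ℚ :* con 0ℚ)) refl (ι d) (ι m) (ι n)))
    (solve 2 (λ a b → con 0ℚ := a :* con 0ℚ :+ con 0ℚ :* b) refl (ι m) (ι n))
    where open ℚ.+-*-Solver

  fromℤ-neg : ∀ n → fromℤ (ℤ.- n) ≡ - fromℤ n
  fromℤ-neg n = cong₂ ⟨_,_⟩ (ι-neg n) refl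

  fromℤ-morphism : CommutativeRing.rawRing ℤ.+-*-commutativeRing
                   ACR.-Raw-AlmostCommutative⟶ ACR.fromCommutativeRing K-commutativeRing
  fromℤ-morphism = record
    { ⟦_⟧ = fromℤ ; +-homo = fromℤ-+ ; *-homo = fromℤ-* ; -‿homo = fromℤ-neg
    ; 0-homo = refl ; 1-homo = refl }

  fromℤ-≟ : ∀ m n → Maybe (fromℤ m ≡ fromℤ n)
  fromℤ-≟ m n = Maybe.map (cong fromℤ) (dec⇒maybe (m ℤ.≟ n))

  module KSolver = RingSolver (CommutativeRing.rawRing ℤ.+-*-commutativeRing)
    (ACR.fromCommutativeRing K-commutativeRing) fromℤ-morphism fromℤ-≟

  fromℤ-^ : ∀ n k → fromℤ (n ℤ.^ k) ≡ fromℤ n K^.^ k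
  fromℤ-^ n zero    = refl
  fromℤ-^ n (suc k) = trans (fromℤ-* n (n ℤ.^ k)) (cong (fromℤ n *_) (fromℤ-^ n k))

  -- Membership of the order ℤ[√d].
  ℤ[√d] : K → Set
  ℤ[√d] x = Integral-ℚ (re x) × Integral-ℚ (im x)

  order-fromℤ : ∀ n → ℤ[√d] (fromℤ n)
  order-fromℤ n = (n , refl) , (0ℤ , refl)

  order-+ : ∀ {x y} → ℤ[√d] x → ℤ[√d] y → ℤ[√d] (x + y)
  order-+ (a , b) (a′ , b′) = integral-+ a a′ , integral-+ b b′

  order-neg : ∀ {x} → ℤ[√d] x → ℤ[√d] (- x)
  order-neg (a , b) = integral-neg a , integral-neg b

  order-* : ∀ {x y} → ℤ[√d] x → ℤ[√d] y → ℤ[√d] (x * y)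
  order-* (a , b) (a′ , b′) =
      integral-+ (integral-* a a′) (integral-* (d , refl) (integral-* b b′))
    , integral-+ (integral-* a b′) (integral-* b a′)

  order-^ : ∀ {x} k → ℤ[√d] x → ℤ[√d] (x K^.^ k)
  order-^ zero    _  = order-fromℤ 1ℤ
  order-^ (suc k) x∈ = order-* x∈ (order-^ k x∈)

  -- x ∈ K is integral iff its powers have a common denominator, iff its trace
  -- and norm are integers. The middle condition is visibly stable under + and *.
  CommonDenominator : ℤ → K → Set
  CommonDenominator N x = ∀ k → ℤ[√d] (fromℤ N * x K^.^ k)

  AlmostIntegral : K → Set
  AlmostIntegral x = ∃[ N ] N ≢ 0ℤ × CommonDenominator N x

  trace norm : K → ℚ
  trace x = re x ℚ.+ re x
  norm  x = re x ℚ.* re x ℚ.- ι d ℚ.* (im x ℚ.* im x)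

  ≢0-* : ∀ m n → m ≢ 0ℤ → n ≢ 0ℤ → m ℤ.* n ≢ 0ℤ
  ≢0-* m n m≢0 n≢0 mn≡0 with ℤ.i*j≡0⇒i≡0∨j≡0 m mn≡0
  ... | inj₁ m≡0 = m≢0 m≡0
  ... | inj₂ n≡0 = n≢0 n≡0

  ≢0-^ : ∀ m k → m ≢ 0ℤ → m ℤ.^ k ≢ 0ℤ
  ≢0-^ m zero    m≢0 ()
  ≢0-^ m (suc k) m≢0 = ≢0-* m (m ℤ.^ k) m≢0 (≢0-^ m k m≢0)

  integral⇒almostIntegral : ∀ {x} → IsAlgebraicInteger x → AlmostIntegral x
  integral⇒almostIntegral {x} (cs , root) = N , ≢0-^ M n M≢0 , common n refl
    where
    open KSolver
    n = length cs
    M = ↧ re x ℤ.* ↧ im x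
    N = M ℤ.^ n

    M≢0 : M ≢ 0ℤ
    M≢0 = ≢0-* (↧ re x) (↧ im x) (↧≢0 (re x)) (↧≢0 (im x))

    q*M : ∀ q e → ι (↧ q ℤ.* e) ℚ.* q ≡ ι (↥ q ℤ.* e)
    q*M q e = begin
      ι (↧ q ℤ.* e) ℚ.* q        ≡⟨ cong (ℚ._* q) (ι-* (↧ q) e) ⟩
      ι (↧ q) ℚ.* ι e ℚ.* q      ≡⟨ ℚS.solve 3 (λ a b c → a ℚS.:* b ℚS.:* c ℚS.:= c ℚS.:* a ℚS.:* b) refl (ι (↧ q)) (ι e) q ⟩
      q ℚ.* ι (↧ q) ℚ.* ι e      ≡⟨ cong (ℚ._* ι e) (q*↧q q) ⟩
      ι (↥ q) ℚ.* ι e            ≡⟨ ι-* (↥ q) e ⟨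
      ι (↥ q ℤ.* e)              ∎
      where
      open ≡-Reasoning
      module ℚS = ℚ.+-*-Solver

    Mx∈ : ℤ[√d] (fromℤ M * x)
    Mx∈ = (↥ re x ℤ.* ↧ im x , trans
            (solve′ 4 (λ δ m a b → m :*′ a :+′ δ :*′ (con′ 0ℚ :*′ b) :=′ m :*′ a) refl (ι d) (ι M) (re x) (im x))
            (q*M (re x) (↧ im x)))
        , (↥ im x ℤ.* ↧ re x , trans
            (trans (solve′ 3 (λ m a b → m :*′ b :+′ con′ 0ℚ :*′ a :=′ m :*′ b) refl (ι M) (re x) (im x))
                   (cong (λ m → ι m ℚ.* im x) (ℤ.*-comm (↧ re x) (↧ im x))))
            (q*M (im x) (↧ re x)))
      where
      open ℚ.+-*-Solver using () renaming (solve to solve′; _:*_ to _:*′_; _:+_ to _:+′_; _:=_ to _:=′_; con to con′)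

    small : ∀ {i m} → i ℕ.≤ m → ℤ[√d] (fromℤ (M ℤ.^ m) * x K^.^ i)
    small {m = m} z≤n = subst ℤ[√d] (sym (𝕂.*-identityʳ (fromℤ (M ℤ.^ m)))) (order-fromℤ (M ℤ.^ m))
    small {suc i} {suc m} (s≤s i≤m) = subst ℤ[√d]
      (begin
        (fromℤ M * x) * (fromℤ (M ℤ.^ m) * x K^.^ i)
          ≡⟨ solve 4 (λ m x n y → (m :* x) :* (n :* y) := (m :* n) :* (x :* y)) refl (fromℤ M) x (fromℤ (M ℤ.^ m)) (x K^.^ i) ⟩
        (fromℤ M * fromℤ (M ℤ.^ m)) * (x * x K^.^ i)
          ≡⟨ cong (_* (x * x K^.^ i)) (fromℤ-* M (M ℤ.^ m)) ⟨
        fromℤ (M ℤ.^ suc m) * (x * x K^.^ i) ∎)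
      (order-* Mx∈ (small i≤m))
      where open ≡-Reasoning

    Good : ℕ → Set
    Good k = ℤ[√d] (fromℤ N * x K^.^ k)

    divide : ∀ cs j → (∀ i → i ℕ.< length cs → Good (i ℕ.+ j)) →
             ℤ[√d] (fromℤ N * x K^.^ j * monic cs x) → Good (length cs ℕ.+ j)
    divide []       j good ev∈ = subst ℤ[√d] (𝕂.*-identityʳ (fromℤ N * x K^.^ j)) ev∈
    divide (c ∷ cs) j good ev∈ = subst Good (ℕ.+-suc (length cs) j)
      (divide cs (suc j)
        (λ i i< → subst Good (sym (ℕ.+-suc i j)) (good (suc i) (s≤s i<)))
        (subst ℤ[√d]
          (solve 5 (λ n y c x m → (n :* y :* (c :+ x :* m)) :+ :- (n :* y :* c) := n :* (x :* y) :* m)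
            refl (fromℤ N) (x K^.^ j) (fromℤ c) x (monic cs x))
          (order-+ ev∈ (order-neg (order-* (good 0 (s≤s z≤n)) (order-fromℤ c))))))

    window : ∀ j i → i ℕ.< n → Good (i ℕ.+ j)
    window zero    i i<n = subst Good (sym (ℕ.+-identityʳ i)) (small (ℕ.<⇒≤ i<n))
    window (suc j) i i<n with ℕ.m≤n⇒m<n∨m≡n i<n
    ... | inj₁ i+1<n = subst Good (sym (ℕ.+-suc i j)) (window j (suc i) i+1<n)
    ... | inj₂ i+1≡n = subst Good (trans (cong (ℕ._+ j) (sym i+1≡n)) (sym (ℕ.+-suc i j)))
      (divide cs j (window j) (subst ℤ[√d]
        (sym (trans (cong (fromℤ N * x K^.^ j *_) root) (𝕂.zeroʳ (fromℤ N * x K^.^ j)))) (order-fromℤ 0ℤ)))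

    common : ∀ m → n ≡ m → CommonDenominator N x
    common zero    n≡0 = ⊥-elim (monic-0 cs n≡0 root)
      where
      monic-0 : ∀ cs → length cs ≡ 0 → monic cs x ≢ 0K
      monic-0 [] _ ()
    common (suc m) n≡ k = window k 0 (subst (0 ℕ.<_) (sym n≡) (s≤s z≤n))

  almostIntegral⇒norm : ∀ {x} → AlmostIntegral x → Integral-ℚ (norm x)
  almostIntegral⇒norm {x} (N , N≢0 , common) =
    almostIntegral⇒integral (norm x) (N ℤ.* N) (≢0-* N N N≢0 N≢0)
      (λ k → subst Integral-ℚ (eq k) (order-norm (common k)))
    where
    open ℚ.+-*-Solver

    order-norm : ∀ {y} → ℤ[√d] y → Integral-ℚ (norm y)
    order-norm (a , b) = integral-+ (integral-* a a) (integral-neg (integral-* (d , refl) (integral-* b b)))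

    norm-* : ∀ y z → norm (y * z) ≡ norm y ℚ.* norm z
    norm-* ⟨ a , b ⟩ ⟨ a′ , b′ ⟩ = solve 5 (λ δ a b a′ b′ →
        (a :* a′ :+ δ :* (b :* b′)) :* (a :* a′ :+ δ :* (b :* b′))
          :- δ :* ((a :* b′ :+ b :* a′) :* (a :* b′ :+ b :* a′))
      := (a :* a :- δ :* (b :* b)) :* (a′ :* a′ :- δ :* (b′ :* b′)))
      refl (ι d) a b a′ b′

    norm-1 : norm 1K ≡ 1ℚ
    norm-1 = solve 1 (λ δ → con 1ℚ :* con 1ℚ :- δ :* (con 0ℚ :* con 0ℚ) := con 1ℚ) refl (ι d)

    norm-^ : ∀ k → norm (x K^.^ k) ≡ norm x ℚ^.^ k
    norm-^ zero    = norm-1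
    norm-^ (suc k) = trans (norm-* x (x K^.^ k)) (cong (norm x ℚ.*_) (norm-^ k))

    norm-fromℤ : norm (fromℤ N) ≡ ι (N ℤ.* N)
    norm-fromℤ = trans
      (solve 2 (λ δ a → a :* a :- δ :* (con 0ℚ :* con 0ℚ) := a :* a) refl (ι d) (ι N))
      (sym (ι-* N N))

    eq : ∀ k → norm (fromℤ N * x K^.^ k) ≡ ι (N ℤ.* N) ℚ.* norm x ℚ^.^ k
    eq k = trans (norm-* (fromℤ N) (x K^.^ k)) (cong₂ ℚ._*_ norm-fromℤ (norm-^ k))

  almostIntegral-fromℤ : ∀ n → AlmostIntegral (fromℤ n)
  almostIntegral-fromℤ n = 1ℤ , (λ ()) , λ k → order-* (order-fromℤ 1ℤ) (order-^ k (order-fromℤ n))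

  almostIntegral-* : ∀ {x y} → AlmostIntegral x → AlmostIntegral y → AlmostIntegral (x * y)
  almostIntegral-* {x} {y} (M , M≢0 , Mx) (N , N≢0 , Ny) =
    M ℤ.* N , ≢0-* M N M≢0 N≢0 , λ k → subst ℤ[√d] (eq k) (order-* (Mx k) (Ny k))
    where
    open KSolver
    xy^ : ∀ k → (x * y) K^.^ k ≡ x K^.^ k * y K^.^ k
    xy^ zero    = sym (𝕂.*-identityʳ 1K)
    xy^ (suc k) = trans (cong (x * y *_) (xy^ k))
      (solve 4 (λ a b c e → a :* b :* (c :* e) := a :* c :* (b :* e)) refl x y (x K^.^ k) (y K^.^ k))

    eq : ∀ k → fromℤ M * x K^.^ k * (fromℤ N * y K^.^ k) ≡ fromℤ (M ℤ.* N) * (x * y) K^.^ k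
    eq k = trans
      (solve 4 (λ a b c e → a :* c :* (b :* e) := a :* b :* (c :* e)) refl (fromℤ M) (fromℤ N) (x K^.^ k) (y K^.^ k))
      (cong₂ _*_ (sym (fromℤ-* M N)) (sym (xy^ k)))

  almostIntegral-+ : ∀ {x y} → AlmostIntegral x → AlmostIntegral y → AlmostIntegral (x + y)
  almostIntegral-+ {x} {y} (M , M≢0 , Mx) (N , N≢0 , Ny) =
    M ℤ.* N , ≢0-* M N M≢0 N≢0 , λ k → subst ℤ[√d]
      (cong (_* (x + y) K^.^ k)
        (trans (cong₂ _*_ (𝕂.*-identityʳ (fromℤ M)) (𝕂.*-identityʳ (fromℤ N))) (sym (fromℤ-* M N))))
      (mixed k 0 0)
    where
    open KSolver
    mixed : ∀ k i j → ℤ[√d] (fromℤ M * x K^.^ i * (fromℤ N * y K^.^ j) * (x + y) K^.^ k)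
    mixed zero    i j = subst ℤ[√d] (sym (𝕂.*-identityʳ (fromℤ M * x K^.^ i * (fromℤ N * y K^.^ j)))) (order-* (Mx i) (Ny j))
    mixed (suc k) i j = subst ℤ[√d]
      (solve 7 (λ x y M N x′ y′ s →
          M :* (x :* x′) :* (N :* y′) :* s :+ M :* x′ :* (N :* (y :* y′)) :* s
        := M :* x′ :* (N :* y′) :* ((x :+ y) :* s))
        refl x y (fromℤ M) (fromℤ N) (x K^.^ i) (y K^.^ j) ((x + y) K^.^ k))
      (order-+ (mixed k (suc i) j) (mixed k i (suc j)))

  almostIntegral⇒trace : ∀ {x} → AlmostIntegral x → Integral-ℚ (trace x)
  almostIntegral⇒trace {x} x∈ = subst Integral-ℚ
    (solve 3 (λ δ a b →
        ((a :+ con 1ℚ) :* (a :+ con 1ℚ) :- δ :* ((b :+ con 0ℚ) :* (b :+ con 0ℚ)))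
          :- (a :* a :- δ :* (b :* b)) :- con 1ℚ
      := a :+ a)
      refl (ι d) (re x) (im x))
    (integral-+ (integral-+ (almostIntegral⇒norm (almostIntegral-+ x∈ (almostIntegral-fromℤ 1ℤ)))
                            (integral-neg (almostIntegral⇒norm x∈)))
                (integral-neg (1ℤ , refl)))
    where open ℚ.+-*-Solver

  trace,norm⇒integral : ∀ {x} → Integral-ℚ (trace x) → Integral-ℚ (norm x) → IsAlgebraicInteger x
  trace,norm⇒integral {x} (t , t≡) (n , n≡) = n ∷ ℤ.- t ∷ [] , (begin
    fromℤ n + x * (fromℤ (ℤ.- t) + x * 1K)
      ≡⟨ cong₂ (λ p q → ⟨ p , 0ℚ ⟩ + x * (⟨ q , 0ℚ ⟩ + x * 1K)) n≡ (trans (cong ℚ.-_ t≡) (sym (ι-neg t))) ⟨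
    ⟨ norm x , 0ℚ ⟩ + x * (⟨ ℚ.- trace x , 0ℚ ⟩ + x * 1K)
      ≡⟨ cong (λ y → ⟨ norm x , 0ℚ ⟩ + x * (⟨ ℚ.- trace x , 0ℚ ⟩ + y)) (𝕂.*-identityʳ x) ⟩
    ⟨ norm x , 0ℚ ⟩ + x * (⟨ ℚ.- trace x , 0ℚ ⟩ + x)
      ≡⟨ cong₂ ⟨_,_⟩
           (solve 3 (λ δ a b → (a :* a :- δ :* (b :* b)) :+ (a :* (:- (a :+ a) :+ a) :+ δ :* (b :* (con 0ℚ :+ b))) := con 0ℚ)
             refl (ι d) (re x) (im x))
           (solve 2 (λ a b → con 0ℚ :+ (a :* (con 0ℚ :+ b) :+ b :* (:- (a :+ a) :+ a)) := con 0ℚ)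
             refl (re x) (im x)) ⟩
    0K ∎)
    where
    open ≡-Reasoning
    open ℚ.+-*-Solver

  almostIntegral⇒isAlgebraicInteger : ∀ {x} → AlmostIntegral x → IsAlgebraicInteger x
  almostIntegral⇒isAlgebraicInteger x∈ = trace,norm⇒integral (almostIntegral⇒trace x∈) (almostIntegral⇒norm x∈)

  isAlgebraicInteger-fromℤ : ∀ n → IsAlgebraicInteger (fromℤ n)
  isAlgebraicInteger-fromℤ n = almostIntegral⇒isAlgebraicInteger (almostIntegral-fromℤ n)

  isAlgebraicInteger-+ : ∀ {x y} → IsAlgebraicInteger x → IsAlgebraicInteger y → IsAlgebraicInteger (x + y)
  isAlgebraicInteger-+ x∈ y∈ = almostIntegral⇒isAlgebraicInteger
    (almostIntegral-+ (integral⇒almostIntegral x∈) (integral⇒almostIntegral y∈))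

  isAlgebraicInteger-* : ∀ {x y} → IsAlgebraicInteger x → IsAlgebraicInteger y → IsAlgebraicInteger (x * y)
  isAlgebraicInteger-* x∈ y∈ = almostIntegral⇒isAlgebraicInteger
    (almostIntegral-* (integral⇒almostIntegral x∈) (integral⇒almostIntegral y∈))

  isAlgebraicInteger-neg : ∀ {x} → IsAlgebraicInteger x → IsAlgebraicInteger (- x)
  isAlgebraicInteger-neg {x} x∈ = subst IsAlgebraicInteger
    (trans (cong (_* x) (fromℤ-neg 1ℤ)) (solve 1 (λ x → :- con 1ℤ :* x := :- x) refl x))
    (isAlgebraicInteger-* (isAlgebraicInteger-fromℤ -1ℤ) x∈)
    where open KSolver

  integral-trace : ∀ {x} → IsAlgebraicInteger x → Integral-ℚ (trace x)
  integral-trace x∈ = almostIntegral⇒trace (integral⇒almostIntegral x∈)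

  integral-norm : ∀ {x} → IsAlgebraicInteger x → Integral-ℚ (norm x)
  integral-norm x∈ = almostIntegral⇒norm (integral⇒almostIntegral x∈)

module RingOfIntegers (d : ℤ) where

  open QuadraticField d

  record O : Set where
    constructor _⊣_
    field
      val       : K
      isInteger : IsAlgebraicInteger val

  open O public

  𝓞-rawRing : RawRing 0ℓ 0ℓ
  𝓞-rawRing = record
    { Carrier = O
    ; _≈_ = λ x y → val x ≡ val y
    ; _+_ = λ x y → (val x + val y) ⊣ isAlgebraicInteger-+ (isInteger x) (isInteger y)
    ; _*_ = λ x y → (val x * val y) ⊣ isAlgebraicInteger-* (isInteger x) (isInteger y)
    ; -_  = λ x → (- val x) ⊣ isAlgebraicInteger-neg (isInteger x)
    ; 0#  = fromℤ 0ℤ ⊣ isAlgebraicInteger-fromℤ 0ℤ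
    ; 1#  = fromℤ 1ℤ ⊣ isAlgebraicInteger-fromℤ 1ℤ
    }

  val-isRingMonomorphism : IsRingMonomorphism 𝓞-rawRing 𝕂.rawRing val
  val-isRingMonomorphism = record
    { isRingHomomorphism = record
      { isSemiringHomomorphism = record
        { isNearSemiringHomomorphism = record
          { +-isMonoidHomomorphism = record
            { isMagmaHomomorphism = record
              { isRelHomomorphism = record { cong = λ eq → eq }
              ; homo = λ _ _ → refl
              }
            ; ε-homo = refl
            }
          ; *-homo = λ _ _ → refl
          }
        ; 1#-homo = refl
        }
      ; -‿homo = λ _ → refl
      }
    ; injective = λ eq → eq
    }

  𝓞 : CommutativeRing 0ℓ 0ℓ
  𝓞 = record
    { isCommutativeRing =
        RingMonomorphism.isCommutativeRing val-isRingMonomorphism 𝕂.isCommutativeRing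
    }

  int : ℤ → O
  int n = fromℤ n ⊣ isAlgebraicInteger-fromℤ n

  int-isRingHomomorphism : IsRingHomomorphism (CommutativeRing.rawRing ℤ.+-*-commutativeRing)
                             (CommutativeRing.rawRing 𝓞) int
  int-isRingHomomorphism = record
    { isSemiringHomomorphism = record
      { isNearSemiringHomomorphism = record
        { +-isMonoidHomomorphism = record
          { isMagmaHomomorphism = record
            { isRelHomomorphism = record { cong = cong fromℤ }
            ; homo = fromℤ-+
            }
          ; ε-homo = refl
          }
        ; *-homo = fromℤ-*
        }
      ; 1#-homo = refl
      }
    ; -‿homo = fromℤ-neg
    }

  -- (1 + √d)/2, a root of X² - X - (d - 1)/4.
  ω : + 4 ∣ d ℤ.- 1ℤ → O
  ω 4∣d-1 = ⟨ ½ , ½ ⟩ ⊣ trace,norm⇒integral (1ℤ , refl) (ℤ.- k , norm≡)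
    where
    open ≡-Reasoning
    open ℚ.+-*-Solver

    4∣′d-1 : + 4 Signed.∣ d ℤ.- 1ℤ
    4∣′d-1 = Signed.∣ᵤ⇒∣ 4∣d-1

    k : ℤ
    k = Signed.quotient 4∣′d-1

    d≡ : d ≡ k ℤ.* + 4 ℤ.+ 1ℤ
    d≡ = begin
      d                       ≡⟨ ℤ.+-identityʳ d ⟨
      d ℤ.+ (-1ℤ ℤ.+ 1ℤ)      ≡⟨ ℤ.+-assoc d -1ℤ 1ℤ ⟨
      d ℤ.- 1ℤ ℤ.+ 1ℤ         ≡⟨ cong (ℤ._+ 1ℤ) (Signed._∣_.equality 4∣′d-1) ⟩
      k ℤ.* + 4 ℤ.+ 1ℤ        ∎

    norm≡ : norm ⟨ ½ , ½ ⟩ ≡ ι (ℤ.- k)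
    norm≡ = begin
      ½ ℚ.* ½ ℚ.- ι d ℚ.* (½ ℚ.* ½)
        ≡⟨ cong (λ δ → ½ ℚ.* ½ ℚ.- ι δ ℚ.* (½ ℚ.* ½)) d≡ ⟩
      ½ ℚ.* ½ ℚ.- ι (k ℤ.* + 4 ℤ.+ 1ℤ) ℚ.* (½ ℚ.* ½)
        ≡⟨ cong (λ δ → ½ ℚ.* ½ ℚ.- δ ℚ.* (½ ℚ.* ½)) (trans (ι-+ (k ℤ.* + 4) 1ℤ) (cong (ℚ._+ 1ℚ) (ι-* k (+ 4)))) ⟩
      ½ ℚ.* ½ ℚ.- (ι k ℚ.* ι (+ 4) ℚ.+ 1ℚ) ℚ.* (½ ℚ.* ½)
        ≡⟨ solve 1 (λ k → con ½ :* con ½ :- (k :* con (ι (+ 4)) :+ con 1ℚ) :* (con ½ :* con ½) := :- k) refl (ι k) ⟩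
      ℚ.- ι k
        ≡⟨ ι-neg k ⟨
      ι (ℤ.- k) ∎

  open CommutativeRing 𝓞 public
    using (_≈_; 0#)
    renaming (_+_ to _⊕_; _*_ to _⊗_)

  -- Preservation of 1 is not required: an endomorphism here may be zero.
  IsEndomorphism : (O → O) → Set
  IsEndomorphism = IsRingWithoutOneHomomorphism
    where
    rng = Ring.rawRingWithoutOne (CommutativeRing.ring 𝓞)
    open RingWithoutOneMorphisms rng rng

  open TwistedDerivations ℤ.+-*-commutativeRing 𝓞 int int-isRingHomomorphism public
    using (Derivation; IsInner; Der; Inn; Out)

{-# OPTIONS --safe #-}

-- Write O = ℤ1 ⊕ ℤω with ω = (1 + √d)/2. A non-zero endomorphism maps 1 to a
-- non-zero idempotent, hence to 1, and 2ω - 1 = √d to a square root of d, hence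
-- to ±√d, so it is the identity or the conjugation; therefore τ(ω) - σ(ω) = ±√d.
-- A (σ,τ)-derivation D kills 1 and is determined by D(ω), and it is inner iff
-- D(ω) ∈ √d O. Comparing coordinates in c₀ + c₁ω = (m + nω)√d gives
-- -c₀ + c₁(d - 1)/2 = md and 2c₀ + c₁ = nd. The derivation with D(ω) = ω violates
-- the second condition.
module Submission where

open import Defs
open import Algebra.Bundles using (CommutativeRing)
open import Algebra.Module.Bundles using (LeftModule)
open import Algebra.Morphism.Structures using (module RingWithoutOneMorphisms)
open import Data.Integer as ℤ using (ℤ; +_; 0ℤ; 1ℤ; -1ℤ; -_; _+_; _-_; _*_; _/_; _%_; NonZero)
open import Data.Integer.Divisibility using (_∣_)
import Data.Integer.Divisibility.Signed as Signed
import Data.Integer.DivMod as ℤ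
import Data.Integer.Properties as ℤ
open import Data.Integer.Tactic.RingSolver using (solve)
open import Data.List using ([]; _∷_)
import Data.Nat as ℕ
import Data.Nat.Coprimality as ℕ
import Data.Nat.Divisibility as ℕ
open import Data.Nat.Primality using (euclidsLemma; prime[2])
open import Data.Product using (_×_; _,_; ∃-syntax; proj₁; proj₂; map₂)
open import Data.Rational as ℚ using (ℚ; 0ℚ; 1ℚ; ½; ↥_; ↧_; ↧ₙ_)
import Data.Rational.Properties as ℚ
import Data.Rational.Solver as ℚ
open import Data.Sum as Sum using (_⊎_; inj₁; inj₂; [_,_]′; reduce)
open import Function.Bundles using (_⇔_; mk⇔)
open import Relation.Binary.PropositionalEquality
open import Relation.Nullary using (¬_; yes; no; contradiction)

-- `O` is defined as the set of all algebraic integers of ℚ[X]/(X² - d), so the basis `1`, `ω` has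
-- to be earned: trace and norm are integers, square-freeness bounds the denominators, and d ≡ 1 mod
-- 4 settles a parity. Inverses in `K` are never formed. Square roots of 1 and of `d` are found by
-- comparing coordinates, using only that ℚ is a domain and that `d` is not a rational square. A
-- sign `s` treats both choices of endomorphisms at once: σ is `twist s` and τ, being different, is
-- `twist (- s)`. The outer derivation comes from τ - σ, which obeys the twisted Leibniz rule, being
-- inner with β = 1. It sends m + nω to ±n√d; dividing by ±√d leaves m + nω ↦ n, which obeys the
-- same rule, and so does its product with ω. That it is not inner rests on `d` not being a unit: 1
-- is excluded by hypothesis and -1 by the congruence.

private module S = ℚ.+-*-Solver
open S using (_:=_; _:+_; _:*_; _:-_; :-_; con)

-- Divisibility of integers and zero products in ℚ.

*-divides : ∀ {a b} c → b ≡ c * a → a ∣ b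
*-divides c eq = Signed.∣⇒∣ᵤ (Signed.divides c eq)

-- The remainder is a multiple of `n` smaller than `∣ n ∣`, hence zero. This makes the quotient
-- `(d - 1ℤ) / + 2` of the theorem a true half.
n∣a⇒[a/n]*n≡a : ∀ a n .{{_ : NonZero n}} → n ∣ a → a / n * n ≡ a
n∣a⇒[a/n]*n≡a a n n∣a = begin
  a / n * n              ≡⟨ ℤ.+-identityˡ (a / n * n) ⟨
  + 0 + a / n * n        ≡⟨ cong (λ r → + r + a / n * n) a%n≡0 ⟨
  + (a % n) + a / n * n  ≡⟨ ℤ.a≡a%n+[a/n]*n a n ⟨
  a                      ∎
  where
  open ≡-Reasoning
  n∣a%n : n ∣ + (a % n)
  n∣a%n = Signed.∣⇒∣ᵤ (Signed.∣m+n∣n⇒∣m {m = + (a % n)}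
    (subst (n Signed.∣_) (ℤ.a≡a%n+[a/n]*n a n) (Signed.∣ᵤ⇒∣ n∣a))
    (Signed.divides (a / n) refl))

  a%n≡0 : a % n ≡ 0
  a%n≡0 with a % n | n∣a%n | ℤ.n%d<d a n
  ... | ℕ.zero  | _    | _   = refl
  ... | ℕ.suc r | n∣r  | r<n = contradiction n∣r (ℕ.>⇒∤ r<n)

2∣m²⇒2∣m : ∀ m → + 2 ∣ m * m → + 2 ∣ m
2∣m²⇒2∣m m 2∣m² = reduce (euclidsLemma ℤ.∣ m ∣ ℤ.∣ m ∣ prime[2] (subst (2 ℕ.∣_) (ℤ.abs-* m m) 2∣m²))

p*q≡0⇒p≡0∨q≡0 : ∀ p {q} → p ℚ.* q ≡ 0ℚ → p ≡ 0ℚ ⊎ q ≡ 0ℚ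
p*q≡0⇒p≡0∨q≡0 p {q} pq≡0 with p ℚ.≟ 0ℚ
... | yes p≡0 = inj₁ p≡0
... | no  p≢0 = inj₂ (begin
  q                      ≡⟨ ℚ.*-identityˡ q ⟨
  1ℚ ℚ.* q               ≡⟨ cong (ℚ._* q) (ℚ.*-inverseˡ p) ⟨
  ℚ.1/ p ℚ.* p ℚ.* q     ≡⟨ ℚ.*-assoc (ℚ.1/ p) p q ⟩
  ℚ.1/ p ℚ.* (p ℚ.* q)   ≡⟨ cong (ℚ.1/ p ℚ.*_) pq≡0 ⟩
  ℚ.1/ p ℚ.* 0ℚ          ≡⟨ ℚ.*-zeroʳ (ℚ.1/ p) ⟩
  0ℚ                     ∎)
  where
  open ≡-Reasoning
  instance
    p-nonZero : ℚ.NonZero p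
    p-nonZero = ℚ.≢-nonZero p≢0

p-q≡0⇒p≡q : ∀ {p q} → p ℚ.- q ≡ 0ℚ → p ≡ q
p-q≡0⇒p≡q {p} {q} eq = trans
  (S.solve 2 (λ p q → p := (p :- q) :+ q) refl p q)
  (trans (cong (ℚ._+ q) eq) (ℚ.+-identityˡ q))

IsSign : ℤ → Set
IsSign s = s ≡ 1ℤ ⊎ s ≡ -1ℤ

q²≡1⇒sign : ∀ q → q ℚ.* q ≡ 1ℚ → ∃[ s ] IsSign s × q ≡ ι s
q²≡1⇒sign q q²≡1 = [ (λ q≡1 → 1ℤ , inj₁ refl , p-q≡0⇒p≡q q≡1)
                   , (λ q≡-1 → -1ℤ , inj₂ refl , p-q≡0⇒p≡q q≡-1)
                   ]′ (p*q≡0⇒p≡0∨q≡0 (q ℚ.- 1ℚ) [q-1][q+1]≡0)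
  where
  [q-1][q+1]≡0 : (q ℚ.- 1ℚ) ℚ.* (q ℚ.- ι -1ℤ) ≡ 0ℚ
  [q-1][q+1]≡0 = trans
    (S.solve 1 (λ q → (q :- con 1ℚ) :* (q :- con (ι -1ℤ)) := q :* q :- con 1ℚ) refl q)
    (cong (ℚ._- 1ℚ) q²≡1)

-- Integer arithmetic of the two divisibility conditions.

i≡i-1+1 : ∀ i → i ≡ i - 1ℤ + 1ℤ
i≡i-1+1 i = solve (i ∷ [])

-- The coordinates of c₀ + c₁ω = (m + nω)√d, where ω = (1 + √d)/2.
DivisibilityWitness : (d c₀ c₁ m n : ℤ) → Set
DivisibilityWitness d c₀ c₁ m n = + 2 * c₀ + c₁ ≡ n * d × c₁ ≡ m * + 2 + n

-- Since d = 2h + 1, twice the first number is c₁d - (2c₀ + c₁) = (2m + n)d - nd = 2md, and the 2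
-- cancels.
witness⇒divisible : ∀ d h c₀ c₁ m n → h * + 2 + 1ℤ ≡ d → DivisibilityWitness d c₀ c₁ m n →
  d ∣ - c₀ + c₁ * h × d ∣ + 2 * c₀ + c₁
witness⇒divisible d h c₀ c₁ m n refl (2c₀+c₁≡nd , c₁≡2m+n) =
  *-divides {d} m (ℤ.*-cancelˡ-≡ (+ 2) (- c₀ + c₁ * h) (m * d) eq) , *-divides {d} n 2c₀+c₁≡nd
  where
  open ≡-Reasoning
  expand : ∀ c₀ c₁ h → + 2 * (- c₀ + c₁ * h) ≡ c₁ * (h * + 2 + 1ℤ) - (+ 2 * c₀ + c₁)
  expand c₀ c₁ h = solve (c₀ ∷ c₁ ∷ h ∷ [])
  collect : ∀ m n d → (m * + 2 + n) * d - n * d ≡ + 2 * (m * d)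
  collect m n d = solve (m ∷ n ∷ d ∷ [])
  eq : + 2 * (- c₀ + c₁ * h) ≡ + 2 * (m * d)
  eq = begin
    + 2 * (- c₀ + c₁ * h)                 ≡⟨ expand c₀ c₁ h ⟩
    c₁ * d - (+ 2 * c₀ + c₁)              ≡⟨ cong₂ (λ a b → a * d - b) c₁≡2m+n 2c₀+c₁≡nd ⟩
    (m * + 2 + n) * d - n * d             ≡⟨ collect m n d ⟩
    + 2 * (m * d)                         ∎

-- The two quotients serve as `m` and `n`. Twice the first number plus the second is c₁d, so c₁d =
-- (2m + n)d, and the non-zero `d` cancels.
divisible⇒witness : ∀ d h c₀ c₁ → d ≢ 0ℤ → h * + 2 + 1ℤ ≡ d → d ∣ - c₀ + c₁ * h → d ∣ + 2 * c₀ + c₁ →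
  ∃[ m ] ∃[ n ] DivisibilityWitness d c₀ c₁ m n
divisible⇒witness d h c₀ c₁ d≢0 refl d∣a d∣b = witness (Signed.∣ᵤ⇒∣ d∣a) (Signed.∣ᵤ⇒∣ d∣b)
  where
  open ≡-Reasoning
  expand : ∀ c₀ c₁ h → c₁ * (h * + 2 + 1ℤ) ≡ (- c₀ + c₁ * h) * + 2 + (+ 2 * c₀ + c₁)
  expand c₀ c₁ h = solve (c₀ ∷ c₁ ∷ h ∷ [])
  collect : ∀ m n d → m * d * + 2 + n * d ≡ (m * + 2 + n) * d
  collect m n d = solve (m ∷ n ∷ d ∷ [])
  instance
    d-nonZero : NonZero d
    d-nonZero = ℤ.≢-nonZero d≢0
  witness : d Signed.∣ - c₀ + c₁ * h → d Signed.∣ + 2 * c₀ + c₁ → ∃[ m ] ∃[ n ] DivisibilityWitness d c₀ c₁ m n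
  witness (Signed.divides m a≡md) (Signed.divides n b≡nd) = m , n , b≡nd , ℤ.*-cancelʳ-≡ c₁ (m * + 2 + n) d (begin
    c₁ * d                                       ≡⟨ expand c₀ c₁ h ⟩
    (- c₀ + c₁ * h) * + 2 + (+ 2 * c₀ + c₁)      ≡⟨ cong₂ (λ a b → a * + 2 + b) a≡md b≡nd ⟩
    m * d * + 2 + n * d                          ≡⟨ collect m n d ⟩
    (m * + 2 + n) * d                            ∎)

∣c₀∣c₁⇒divisible : ∀ d h c₀ c₁ → d ∣ c₀ → d ∣ c₁ → d ∣ - c₀ + c₁ * h × d ∣ + 2 * c₀ + c₁
∣c₀∣c₁⇒divisible d h c₀ c₁ d∣c₀ d∣c₁ = multiples (Signed.∣ᵤ⇒∣ d∣c₀) (Signed.∣ᵤ⇒∣ d∣c₁)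
  where
  multiples : d Signed.∣ c₀ → d Signed.∣ c₁ → d ∣ - c₀ + c₁ * h × d ∣ + 2 * c₀ + c₁
  multiples (Signed.divides a refl) (Signed.divides b refl) =
    *-divides {d} (- a + b * h) (lemma₁ a b h d) , *-divides {d} (+ 2 * a + b) (lemma₂ a b d)
    where
    lemma₁ : ∀ a b h d → - (a * d) + b * d * h ≡ (- a + b * h) * d
    lemma₁ a b h d = solve (a ∷ b ∷ h ∷ d ∷ [])
    lemma₂ : ∀ a b d → + 2 * (a * d) + b * d ≡ (+ 2 * a + b) * d
    lemma₂ a b d = solve (a ∷ b ∷ d ∷ [])

-- Square-freeness and the integral basis.

module QuadraticIntegers (d : ℤ) (sf : SquareFree d) (4∣d-1 : + 4 ∣ d - 1ℤ) (d≢1 : d ≢ 1ℤ) where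

  open QuadraticField d
    using (K; ⟨_,_⟩; re; im; fromℤ; 0K; 1K; trace; norm; IsAlgebraicInteger; integral-trace; integral-norm;
           isAlgebraicInteger-*; isAlgebraicInteger-fromℤ; module 𝕂; module KSolver; fromℤ-+; fromℤ-*; fromℤ-neg)
    renaming (_+_ to _+ᴷ_; _*_ to _*ᴷ_; -_ to -ᴷ_)
  open RingOfIntegers d
  open ≡-Reasoning
  open KSolver using () renaming (solve to solveᴷ; _:+_ to _:+ᴷ_; _:*_ to _:*ᴷ_; :-_ to :-ᴷ_; con to conᴷ; _:=_ to _:=ᴷ_)

  4∣′d-1 : + 4 Signed.∣ d - 1ℤ
  4∣′d-1 = Signed.∣ᵤ⇒∣ 4∣d-1

  k : ℤ
  k = Signed.quotient 4∣′d-1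

  d≡4k+1 : d ≡ k * + 4 + 1ℤ
  d≡4k+1 = trans (i≡i-1+1 d) (cong (_+ 1ℤ) (Signed._∣_.equality 4∣′d-1))

  d≢0 : d ≢ 0ℤ
  -- If `d` were 0, then `0ℤ` would be a square divisor whose absolute value is not 1.
  d≢0 refl = contradiction (sf 0ℤ (0 ℕ.∣0)) λ ()

  -- The square of the denominator of q divides d.
  dq²-integral⇒q-integral : ∀ q → Integral-ℚ (ι d ℚ.* (q ℚ.* q)) → Integral-ℚ q
  dq²-integral⇒q-integral q (n , dq²≡n) = ↧≡1⇒integral q (sf (↧ q) ↧²∣d)
    where
    d↥²≡n↧² : d * (↥ q * ↥ q) ≡ n * (↧ q * ↧ q)
    d↥²≡n↧² = ι-injective (begin
      ι (d * (↥ q * ↥ q))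
        ≡⟨ trans (ι-* d (↥ q * ↥ q)) (cong (ι d ℚ.*_) (ι-* (↥ q) (↥ q))) ⟩
      ι d ℚ.* (ι (↥ q) ℚ.* ι (↥ q))
        ≡⟨ cong (λ p → ι d ℚ.* (p ℚ.* p)) (q*↧q q) ⟨
      ι d ℚ.* (q ℚ.* ι (↧ q) ℚ.* (q ℚ.* ι (↧ q)))
        ≡⟨ S.solve 3 (λ d q e → d :* (q :* e :* (q :* e)) := d :* (q :* q) :* (e :* e)) refl (ι d) q (ι (↧ q)) ⟩
      ι d ℚ.* (q ℚ.* q) ℚ.* (ι (↧ q) ℚ.* ι (↧ q))
        ≡⟨ cong (ℚ._* (ι (↧ q) ℚ.* ι (↧ q))) dq²≡n ⟩
      ι n ℚ.* (ι (↧ q) ℚ.* ι (↧ q))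
        ≡⟨ trans (ι-* n (↧ q * ↧ q)) (cong (ι n ℚ.*_) (ι-* (↧ q) (↧ q))) ⟨
      ι (n * (↧ q * ↧ q)) ∎)

    ↧²⊥↥² : ℕ.Coprime ℤ.∣ ↧ q * ↧ q ∣ ℤ.∣ ↥ q * ↥ q ∣
    ↧²⊥↥² = subst₂ ℕ.Coprime (sym (ℤ.abs-* (↧ q) (↧ q))) (sym (ℤ.abs-* (↥ q) (↥ q)))
      (coprime-* ↧⊥↥² ↧⊥↥²)
      where
      ↧⊥↥² : ℕ.Coprime (↧ₙ q) (ℤ.∣ ↥ q ∣ ℕ.* ℤ.∣ ↥ q ∣)
      ↧⊥↥² = ℕ.sym (coprime-* (↥⊥↧ q) (↥⊥↧ q))

    ↧²∣d : ↧ q * ↧ q ∣ d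
    ↧²∣d = ℕ.coprime-divisor {o = ℤ.∣ d ∣} ↧²⊥↥²
      (subst (ℤ.∣ ↧ q * ↧ q ∣ ℕ.∣_) (ℤ.abs-* (↥ q * ↥ q) d)
        (*-divides {↧ q * ↧ q} n (trans (ℤ.*-comm (↥ q * ↥ q) d) d↥²≡n↧²)))

  -- From q² = d it follows that dq² = d² is an integer, so `q` is an integer `n` by the denominator
  -- bound. Then `n * n` divides `d`, square-freeness gives `∣ n ∣` = 1, and `d` would be 1.
  q²≢d : ∀ q → q ℚ.* q ≢ ι d
  q²≢d q q²≡d = d≢1 (trans (sym n²≡d) (n²≡1 n (sf n
      (*-divides {n * n} 1ℤ (trans (sym n²≡d) (sym (ℤ.*-identityˡ (n * n))))))))
    where
    q-integral : Integral-ℚ q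
    q-integral = dq²-integral⇒q-integral q (d * d , trans (cong (ι d ℚ.*_) q²≡d) (sym (ι-* d d)))

    n = proj₁ q-integral

    n²≡d : n * n ≡ d
    n²≡d = ι-injective (trans (ι-* n n) (subst (λ p → p ℚ.* p ≡ ι d) (proj₂ q-integral) q²≡d))

    n²≡1 : ∀ m → ℤ.∣ m ∣ ≡ 1 → m * m ≡ 1ℤ
    n²≡1 (+ _)      refl = refl
    n²≡1 ℤ.-[1+ _ ] refl = refl

  ιd≡ : ι d ≡ ι k ℚ.* ι (+ 4) ℚ.+ 1ℚ
  ιd≡ = trans (cong ι d≡4k+1) (trans (ι-+ (k * + 4) 1ℤ) (cong (ℚ._+ 1ℚ) (ι-* k (+ 4))))

  ιd≢0 : ι d ≢ 0ℚ
  ιd≢0 eq = d≢0 (ι-injective eq)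

  half : ∀ {p q} → p ℚ.+ p ≡ q → p ≡ ½ ℚ.* q
  half {p} eq = trans (S.solve 1 (λ p → p := con ½ :* (p :+ p)) refl p) (cong (½ ℚ.*_) eq)

  ωᴷ : K
  ωᴷ = ⟨ ½ , ½ ⟩

  √d : K
  √d = ⟨ 0ℚ , 1ℚ ⟩

  ωᴷ²≡ωᴷ+k : ωᴷ *ᴷ ωᴷ ≡ ωᴷ +ᴷ fromℤ k
  ωᴷ²≡ωᴷ+k = cong₂ ⟨_,_⟩
    (trans (cong (λ δ → ½ ℚ.* ½ ℚ.+ δ ℚ.* (½ ℚ.* ½)) ιd≡)
      (S.solve 1 (λ k → con ½ :* con ½ :+ (k :* con (ι (+ 4)) :+ con 1ℚ) :* (con ½ :* con ½)
           := con ½ :+ k)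
           refl (ι k)))
    refl

  -- With trace `t`, norm `N` and `w` twice the √d-coordinate, dw² = t² - 4N is an integer, so `w`
  -- is an integer `u`. As `t` and `u` have the same parity, x = (t + u√d)/2 = (t - u)/2 + uω.
  1,ω-span : ∀ (x : O) → ∃[ m ] ∃[ n ] val x ≡ fromℤ m +ᴷ fromℤ n *ᴷ ωᴷ
  1,ω-span x = m , u , cong₂ ⟨_,_⟩
    (begin
      re (val x)                 ≡⟨ half (trans t≡ (trans (cong ι t≡2m+u) (ι-+ (m * + 2) u))) ⟩
      ½ ℚ.* (ι (m * + 2) ℚ.+ ι u)  ≡⟨ cong (λ e → ½ ℚ.* (e ℚ.+ ι u)) (ι-* m (+ 2)) ⟩
      ½ ℚ.* (ι m ℚ.* ι (+ 2) ℚ.+ ι u)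
        ≡⟨ S.solve 3 (λ δ m u → con ½ :* (m :* con (ι (+ 2)) :+ u)
             := m :+ (u :* con ½ :+ δ :* (con 0ℚ :* con ½)))
             refl (ι d) (ι m) (ι u) ⟩
      ι m ℚ.+ (ι u ℚ.* ½ ℚ.+ ι d ℚ.* (0ℚ ℚ.* ½)) ∎)
    (trans (half u≡) (S.solve 1 (λ u → con ½ :* u := con 0ℚ :+ (u :* con ½ :+ con 0ℚ :* con ½)) refl (ι u)))
    where
    w : ℚ
    w = im (val x) ℚ.+ im (val x)

    t,t≡ : Integral-ℚ (trace (val x))
    t,t≡ = integral-trace (isInteger x)

    N,N≡ : Integral-ℚ (norm (val x))
    N,N≡ = integral-norm (isInteger x)

    t = proj₁ t,t≡
    t≡ = proj₂ t,t≡
    N = proj₁ N,N≡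

    dw²≡ : ι d ℚ.* (w ℚ.* w) ≡ ι (t * t - + 4 * N)
    dw²≡ = begin
      ι d ℚ.* (w ℚ.* w)
        ≡⟨ S.solve 3 (λ δ a b → δ :* ((b :+ b) :* (b :+ b))
             := (a :+ a) :* (a :+ a) :- con (ι (+ 4)) :* (a :* a :- δ :* (b :* b)))
             refl (ι d) (re (val x)) (im (val x)) ⟩
      trace (val x) ℚ.* trace (val x) ℚ.- ι (+ 4) ℚ.* norm (val x)
        ≡⟨ cong₂ (λ t N → t ℚ.* t ℚ.- ι (+ 4) ℚ.* N) t≡ (proj₂ N,N≡) ⟩
      ι t ℚ.* ι t ℚ.- ι (+ 4) ℚ.* ι N
        ≡⟨ cong₂ ℚ._-_ (ι-* t t) (ι-* (+ 4) N) ⟨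
      ι (t * t) ℚ.- ι (+ 4 * N)
        ≡⟨ cong (ι (t * t) ℚ.+_) (ι-neg (+ 4 * N)) ⟨
      ι (t * t) ℚ.+ ι (- (+ 4 * N))
        ≡⟨ ι-+ (t * t) (- (+ 4 * N)) ⟨
      ι (t * t - + 4 * N) ∎

    u,u≡ : Integral-ℚ w
    u,u≡ = dq²-integral⇒q-integral w (t * t - + 4 * N , dw²≡)

    u = proj₁ u,u≡
    u≡ = proj₂ u,u≡

    du²≡ : d * (u * u) ≡ t * t - + 4 * N
    du²≡ = ι-injective (begin
      ι (d * (u * u))          ≡⟨ trans (ι-* d (u * u)) (cong (ι d ℚ.*_) (ι-* u u)) ⟩
      ι d ℚ.* (ι u ℚ.* ι u)    ≡⟨ cong (λ w → ι d ℚ.* (w ℚ.* w)) u≡ ⟨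
      ι d ℚ.* (w ℚ.* w)        ≡⟨ dw²≡ ⟩
      ι (t * t - + 4 * N)      ∎)

    -- d ≡ 1 mod 4 makes t and u congruent mod 2.
    square-even : ∀ t u N k d → d ≡ k * + 4 + 1ℤ → d * (u * u) ≡ t * t - + 4 * N →
      (t - u) * (t - u) ≡ ((+ 2 * k + 1ℤ) * (u * u) - t * u + + 2 * N) * + 2
    square-even t u N k d d≡4k+1 du²≡ = begin
      (t - u) * (t - u)
        ≡⟨ solve (t ∷ u ∷ N ∷ []) ⟩
      (t * t - + 4 * N) + (u * u - + 2 * (t * u) + + 4 * N)
        ≡⟨ cong (_+ (u * u - + 2 * (t * u) + + 4 * N)) (trans (sym du²≡) (cong (_* (u * u)) d≡4k+1)) ⟩
      (k * + 4 + 1ℤ) * (u * u) + (u * u - + 2 * (t * u) + + 4 * N)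
        ≡⟨ solve (k ∷ t ∷ u ∷ N ∷ []) ⟩
      ((+ 2 * k + 1ℤ) * (u * u) - t * u + + 2 * N) * + 2 ∎

    2∣t-u : + 2 Signed.∣ t - u
    2∣t-u = Signed.∣ᵤ⇒∣ (2∣m²⇒2∣m (t - u) (*-divides {+ 2} ((+ 2 * k + 1ℤ) * (u * u) - t * u + + 2 * N)
      (square-even t u N k d d≡4k+1 du²≡)))

    m = Signed.quotient 2∣t-u

    t≡2m+u : t ≡ m * + 2 + u
    t≡2m+u = trans (lemma t u) (cong (_+ u) (Signed._∣_.equality 2∣t-u))
      where
      lemma : ∀ t u → t ≡ t - u + u
      lemma t u = solve (t ∷ u ∷ [])

  -- Square roots of 1 and of `d` in `K`.

  square≡integer : ∀ (z : K) n → z *ᴷ z ≡ fromℤ n →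
    (re z ≡ 0ℚ × ι d ℚ.* (im z ℚ.* im z) ≡ ι n) ⊎ (im z ≡ 0ℚ × re z ℚ.* re z ≡ ι n)
  square≡integer z@(⟨ p , q ⟩) n z²≡n = Sum.map
    (λ { refl → refl , trans (S.solve 2 (λ δ q → δ :* (q :* q) := con 0ℚ :* con 0ℚ :+ δ :* (q :* q)) refl (ι d) q) (cong re z²≡n) })
    (λ { refl → refl , trans (S.solve 2 (λ δ p → p :* p := p :* p :+ δ :* (con 0ℚ :* con 0ℚ)) refl (ι d) p) (cong re z²≡n) })
    -- The √d-coordinate of z² is 2pq, and it vanishes because z² is an integer.
    (p*q≡0⇒p≡0∨q≡0 p (trans
      (S.solve 2 (λ p q → p :* q := con ½ :* (p :* q :+ q :* p)) refl p q)
      (cong (½ ℚ.*_) (cong im z²≡n))))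

  -- If z = q√d, then (dq)² = d, which q²≢d excludes.
  z²≡1⇒sign : ∀ z → z *ᴷ z ≡ 1K → ∃[ s ] IsSign s × z ≡ fromℤ s
  z²≡1⇒sign z z²≡1 = [ (λ (_ , dq²≡1) → contradiction (dq-squared (im z) dq²≡1) (q²≢d (ι d ℚ.* im z)))
                     , (λ (q≡0 , p²≡1) → map₂ (map₂ (λ p≡s → cong₂ ⟨_,_⟩ p≡s q≡0)) (q²≡1⇒sign (re z) p²≡1))
                     ]′ (square≡integer z 1ℤ z²≡1)
    where
    dq-squared : ∀ q → ι d ℚ.* (q ℚ.* q) ≡ 1ℚ → ι d ℚ.* q ℚ.* (ι d ℚ.* q) ≡ ι d
    dq-squared q eq = trans (S.solve 2 (λ δ q → δ :* q :* (δ :* q) := δ :* (δ :* (q :* q))) refl (ι d) q)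
      (trans (cong (ι d ℚ.*_) eq) (ℚ.*-identityʳ (ι d)))

  z²≡d⇒±√d : ∀ z → z *ᴷ z ≡ fromℤ d → ∃[ s ] IsSign s × z ≡ ⟨ 0ℚ , ι s ⟩
  z²≡d⇒±√d z z²≡d = [ (λ (p≡0 , dq²≡d) → map₂ (map₂ (λ q≡s → cong₂ ⟨_,_⟩ p≡0 q≡s)) (q²≡1⇒sign (im z) (q²≡1 (im z) dq²≡d)))
                    , (λ (_ , p²≡d) → contradiction p²≡d (q²≢d (re z)))
                    ]′ (square≡integer z d z²≡d)
    where
    q²≡1 : ∀ q → ι d ℚ.* (q ℚ.* q) ≡ ι d → q ℚ.* q ≡ 1ℚ
    q²≡1 q eq = [ (λ d≡0 → contradiction d≡0 ιd≢0) , p-q≡0⇒p≡q ]′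
      (p*q≡0⇒p≡0∨q≡0 (ι d) (trans
        (S.solve 2 (λ δ q → δ :* (q :* q :- con 1ℚ) := δ :* (q :* q) :- δ) refl (ι d) q)
        (trans (cong (ℚ._- ι d) eq) (ℚ.+-inverseʳ (ι d)))))

  -- Classification of the non-zero endomorphisms.

  1ᴼ ωᴼ : O
  1ᴼ = int 1ℤ
  ωᴼ = ω 4∣d-1

  -- The values are related by equations in K because comparing two compound
  -- terms of O makes Agda unfold their integrality proofs.
  IsAdditive : (O → O) → Set
  IsAdditive f = ∀ x y z → val z ≡ val x +ᴷ val y → val (f z) ≡ val (f x) +ᴷ val (f y)

  IsHomogeneous : (O → O) → Set
  IsHomogeneous f = ∀ n x z → val z ≡ fromℤ n *ᴷ val x → val (f z) ≡ fromℤ n *ᴷ val (f x)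

  scale : ℤ → O → O
  scale n x = int n ⊗ x

  linear-on-span : ∀ {f} → IsAdditive f → IsHomogeneous f →
    ∀ x m n → val x ≡ fromℤ m +ᴷ fromℤ n *ᴷ ωᴷ →
    val (f x) ≡ fromℤ m *ᴷ val (f 1ᴼ) +ᴷ fromℤ n *ᴷ val (f ωᴼ)
  linear-on-span {f} additive homogeneous x m n x≡ = trans
    (additive (scale m 1ᴼ) (scale n ωᴼ) x (trans x≡ (cong (_+ᴷ fromℤ n *ᴷ ωᴷ) (sym (𝕂.*-identityʳ (fromℤ m))))))
    (cong₂ _+ᴷ_ (homogeneous m 1ᴼ (scale m 1ᴼ) refl) (homogeneous n ωᴼ (scale n ωᴼ) refl))

  2y-1 : K → K
  2y-1 y = y +ᴷ y +ᴷ -ᴷ 1K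

  -- (2y - 1)² = 4(y² - y) + 1. The case c = 0 is the idempotent σ(1), with value 1; the case c =
  -- `k` is σ(ω), with value 4k + 1 = d.
  complete-square : ∀ y c → y *ᴷ y ≡ y +ᴷ fromℤ c → 2y-1 y *ᴷ 2y-1 y ≡ fromℤ (c * + 4 + 1ℤ)
  complete-square y c y²≡ = begin
    2y-1 y *ᴷ 2y-1 y
      ≡⟨ solveᴷ 1 (λ y → (y :+ᴷ y :+ᴷ (:-ᴷ conᴷ 1ℤ)) :*ᴷ (y :+ᴷ y :+ᴷ (:-ᴷ conᴷ 1ℤ))
           :=ᴷ (y :*ᴷ y :+ᴷ (:-ᴷ y)) :*ᴷ conᴷ (+ 4) :+ᴷ conᴷ 1ℤ)
           refl y ⟩
    (y *ᴷ y +ᴷ -ᴷ y) *ᴷ fromℤ (+ 4) +ᴷ fromℤ 1ℤ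
      ≡⟨ cong (λ y² → (y² +ᴷ -ᴷ y) *ᴷ fromℤ (+ 4) +ᴷ fromℤ 1ℤ) y²≡ ⟩
    (y +ᴷ fromℤ c +ᴷ -ᴷ y) *ᴷ fromℤ (+ 4) +ᴷ fromℤ 1ℤ
      ≡⟨ solveᴷ 2 (λ y c → (y :+ᴷ c :+ᴷ (:-ᴷ y)) :*ᴷ conᴷ (+ 4) :+ᴷ conᴷ 1ℤ
           :=ᴷ c :*ᴷ conᴷ (+ 4) :+ᴷ conᴷ 1ℤ)
           refl y (fromℤ c) ⟩
    fromℤ c *ᴷ fromℤ (+ 4) +ᴷ fromℤ 1ℤ
      ≡⟨ cong (_+ᴷ fromℤ 1ℤ) (fromℤ-* c (+ 4)) ⟨
    fromℤ (c * + 4) +ᴷ fromℤ 1ℤ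
      ≡⟨ fromℤ-+ (c * + 4) 1ℤ ⟨
    fromℤ (c * + 4 + 1ℤ) ∎

  2y-1≡⇒y≡ : ∀ y z → 2y-1 y ≡ z → y ≡ ⟨ ½ ℚ.* (re z ℚ.+ 1ℚ) , ½ ℚ.* im z ⟩
  2y-1≡⇒y≡ y z refl = cong₂ ⟨_,_⟩
    (S.solve 1 (λ a → a := con ½ :* (a :+ a :+ (:- con 1ℚ) :+ con 1ℚ)) refl (re y))
    (S.solve 1 (λ b → b := con ½ :* (b :+ b :+ (:- con 0ℚ))) refl (im y))

  -- The identity for s = 1, the conjugation for s = -1.
  twist : ℤ → K → K
  twist s z = ⟨ re z , ι s ℚ.* im z ⟩

  twist-1 : ∀ s → twist s 1K ≡ 1K
  twist-1 s = cong ⟨ 1ℚ ,_⟩ (ℚ.*-zeroʳ (ι s))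

  -- `⟨ ½ , ½ ℚ.* ι s ⟩` is the twist of `ωᴷ`, in the form in which `2y-1≡⇒y≡` delivers σ(ω).
  twist-combination : ∀ s m n → fromℤ m *ᴷ 1K +ᴷ fromℤ n *ᴷ ⟨ ½ , ½ ℚ.* ι s ⟩ ≡ twist s (fromℤ m +ᴷ fromℤ n *ᴷ ωᴷ)
  twist-combination s m n = cong₂ ⟨_,_⟩
    (S.solve 4 (λ δ s m n → (m :* con 1ℚ :+ δ :* (con 0ℚ :* con 0ℚ)) :+ (n :* con ½ :+ δ :* (con 0ℚ :* (con ½ :* s)))
                := m :+ (n :* con ½ :+ δ :* (con 0ℚ :* con ½))) refl (ι d) (ι s) (ι m) (ι n))
    (S.solve 3 (λ s m n → (m :* con 0ℚ :+ con 0ℚ :* con 1ℚ) :+ (n :* (con ½ :* s) :+ con 0ℚ :* con ½)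
                := s :* (con 0ℚ :+ (n :* con ½ :+ con 0ℚ :* con ½))) refl (ι s) (ι m) (ι n))

  module _ (σ : O → O) (σ-hom : IsEndomorphism σ) where

    private
      module E = RingWithoutOneMorphisms.IsRingWithoutOneHomomorphism σ-hom

    σ-additive : IsAdditive σ
    σ-additive x y z z≡ = trans (E.⟦⟧-cong {z} {x ⊕ y} z≡) (E.+-homo x y)

    σ-multiplicative : ∀ x y z → val z ≡ val x *ᴷ val y → val (σ z) ≡ val (σ x) *ᴷ val (σ y)
    σ-multiplicative x y z z≡ = trans (E.⟦⟧-cong {z} {x ⊗ y} z≡) (E.*-homo x y)

    -- An endomorphism comes with additivity alone, so compatibility with integer multiples is
    -- rebuilt by adding one copy of `x` at a time; negative multiples follow by negation.
    σ-homogeneous-ℕ : ∀ n x z → val z ≡ fromℤ (+ n) *ᴷ val x → val (σ z) ≡ fromℤ (+ n) *ᴷ val (σ x)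
    σ-homogeneous-ℕ ℕ.zero x z z≡ = begin
      val (σ z)              ≡⟨ E.⟦⟧-cong {z} {0#} (trans z≡ (𝕂.zeroˡ (val x))) ⟩
      val (σ 0#)             ≡⟨ E.0#-homo ⟩
      0K                     ≡⟨ 𝕂.zeroˡ (val (σ x)) ⟨
      0K *ᴷ val (σ x)        ∎
    σ-homogeneous-ℕ (ℕ.suc n) x z z≡ = begin
      val (σ z)                                ≡⟨ σ-additive x (scale (+ n) x) z (trans z≡ (fromℤ-suc (val x))) ⟩
      val (σ x) +ᴷ val (σ (scale (+ n) x))     ≡⟨ cong (val (σ x) +ᴷ_) (σ-homogeneous-ℕ n x (scale (+ n) x) refl) ⟩
      val (σ x) +ᴷ fromℤ (+ n) *ᴷ val (σ x)    ≡⟨ fromℤ-suc (val (σ x)) ⟨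
      fromℤ (+ ℕ.suc n) *ᴷ val (σ x)           ∎
      where
      fromℤ-suc : ∀ y → fromℤ (+ ℕ.suc n) *ᴷ y ≡ y +ᴷ fromℤ (+ n) *ᴷ y
      fromℤ-suc y = trans (cong (_*ᴷ y) (fromℤ-+ 1ℤ (+ n)))
        (solveᴷ 2 (λ n y → (conᴷ 1ℤ :+ᴷ n) :*ᴷ y :=ᴷ y :+ᴷ n :*ᴷ y) refl (fromℤ (+ n)) y)

    σ-homogeneous : IsHomogeneous σ
    σ-homogeneous (+ n)      = σ-homogeneous-ℕ n
    σ-homogeneous ℤ.-[1+ n ] x z z≡ = begin
      val (σ z)                           ≡⟨ negative (scale (+ ℕ.suc n) x) (trans z≡ (fromℤ-negative (val x))) ⟩
      -ᴷ val (σ (scale (+ ℕ.suc n) x))    ≡⟨ cong -ᴷ_ (σ-homogeneous-ℕ (ℕ.suc n) x (scale (+ ℕ.suc n) x) refl) ⟩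
      -ᴷ (fromℤ (+ ℕ.suc n) *ᴷ val (σ x)) ≡⟨ fromℤ-negative (val (σ x)) ⟨
      fromℤ ℤ.-[1+ n ] *ᴷ val (σ x)       ∎
      where
      open CommutativeRing 𝓞 using () renaming (-_ to -ᴼ_)
      negative : ∀ w → val z ≡ -ᴷ val w → val (σ z) ≡ -ᴷ val (σ w)
      negative w z≡-w = trans (E.⟦⟧-cong {z} { -ᴼ w} z≡-w) (E.⁻¹-homo w)

      fromℤ-negative : ∀ y → fromℤ ℤ.-[1+ n ] *ᴷ y ≡ -ᴷ (fromℤ (+ ℕ.suc n) *ᴷ y)
      fromℤ-negative y = trans (cong (_*ᴷ y) (fromℤ-neg (+ ℕ.suc n)))
        (solveᴷ 2 (λ n y → (:-ᴷ n) :*ᴷ y :=ᴷ :-ᴷ (n :*ᴷ y)) refl (fromℤ (+ ℕ.suc n)) y)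

    -- Idempotency of σ(1); the summand `fromℤ 0ℤ` gives it the shape that `complete-square`
    -- expects.
    σ1²≡ : val (σ 1ᴼ) *ᴷ val (σ 1ᴼ) ≡ val (σ 1ᴼ) +ᴷ fromℤ 0ℤ
    σ1²≡ = trans (sym (σ-multiplicative 1ᴼ 1ᴼ 1ᴼ (sym (𝕂.*-identityʳ 1K)))) (sym (𝕂.+-identityʳ (val (σ 1ᴼ))))

    σ1≡0⇒σ≈0 : val (σ 1ᴼ) ≡ 0K → ∀ x → σ x ≈ 0#
    σ1≡0⇒σ≈0 σ1≡0 x = begin
      val (σ x)                  ≡⟨ σ-multiplicative 1ᴼ x x (sym (𝕂.*-identityˡ (val x))) ⟩
      val (σ 1ᴼ) *ᴷ val (σ x)    ≡⟨ cong (_*ᴷ val (σ x)) σ1≡0 ⟩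
      0K *ᴷ val (σ x)            ≡⟨ 𝕂.zeroˡ (val (σ x)) ⟩
      0K                         ∎

    module _ (σ≉0 : ¬ (∀ x → σ x ≈ 0#)) where

      -- 2σ(1) - 1 is a square root of 1, hence a sign. The sign -1 would mean σ(1) = 0, and then
      -- σ(x) = σ(1)σ(x) vanishes everywhere.
      σ1≡1 : val (σ 1ᴼ) ≡ 1K
      σ1≡1 =
        let (_ , sign , z≡s) = z²≡1⇒sign (2y-1 (val (σ 1ᴼ))) (complete-square (val (σ 1ᴼ)) 0ℤ σ1²≡)
        in positive sign z≡s
        where
        positive : ∀ {s} → IsSign s → 2y-1 (val (σ 1ᴼ)) ≡ fromℤ s → val (σ 1ᴼ) ≡ 1K
        positive (inj₁ refl) z≡1  = 2y-1≡⇒y≡ (val (σ 1ᴼ)) (fromℤ 1ℤ) z≡1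
        positive (inj₂ refl) z≡-1 = contradiction (σ1≡0⇒σ≈0 (2y-1≡⇒y≡ (val (σ 1ᴼ)) (fromℤ -1ℤ) z≡-1)) σ≉0

      σω²≡ : val (σ ωᴼ) *ᴷ val (σ ωᴼ) ≡ val (σ ωᴼ) +ᴷ fromℤ k
      σω²≡ = begin
        val (σ ωᴼ) *ᴷ val (σ ωᴼ)                ≡⟨ σ-multiplicative ωᴼ ωᴼ (ωᴼ ⊗ ωᴼ) refl ⟨
        val (σ (ωᴼ ⊗ ωᴼ))                       ≡⟨ σ-additive ωᴼ (scale k 1ᴼ) (ωᴼ ⊗ ωᴼ)
                                                      (trans ωᴷ²≡ωᴷ+k (cong (ωᴷ +ᴷ_) (sym (𝕂.*-identityʳ (fromℤ k))))) ⟩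
        val (σ ωᴼ) +ᴷ val (σ (scale k 1ᴼ))      ≡⟨ cong (val (σ ωᴼ) +ᴷ_) (σ-homogeneous k 1ᴼ (scale k 1ᴼ) refl) ⟩
        val (σ ωᴼ) +ᴷ fromℤ k *ᴷ val (σ 1ᴼ)     ≡⟨ cong (λ y → val (σ ωᴼ) +ᴷ fromℤ k *ᴷ y) σ1≡1 ⟩
        val (σ ωᴼ) +ᴷ fromℤ k *ᴷ 1K             ≡⟨ cong (val (σ ωᴼ) +ᴷ_) (𝕂.*-identityʳ (fromℤ k)) ⟩
        val (σ ωᴼ) +ᴷ fromℤ k                   ∎

      nonzero-endomorphism⇒twist : ∃[ s ] IsSign s × ∀ x → val (σ x) ≡ twist s (val x)
      nonzero-endomorphism⇒twist = conclude σω-sign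
        where
        z²≡d : 2y-1 (val (σ ωᴼ)) *ᴷ 2y-1 (val (σ ωᴼ)) ≡ fromℤ d
        z²≡d = trans (complete-square (val (σ ωᴼ)) k σω²≡) (cong fromℤ (sym d≡4k+1))

        twisted : ∀ {s} → 2y-1 (val (σ ωᴼ)) ≡ ⟨ 0ℚ , ι s ⟩ →
          ∀ x → (∃[ m ] ∃[ n ] val x ≡ fromℤ m +ᴷ fromℤ n *ᴷ ωᴷ) → val (σ x) ≡ twist s (val x)
        twisted {s} z≡ x (m , n , x≡) = begin
          val (σ x)                                         ≡⟨ linear-on-span {σ} σ-additive σ-homogeneous x m n x≡ ⟩
          fromℤ m *ᴷ val (σ 1ᴼ) +ᴷ fromℤ n *ᴷ val (σ ωᴼ)
            ≡⟨ cong₂ (λ y z → fromℤ m *ᴷ y +ᴷ fromℤ n *ᴷ z) σ1≡1 (2y-1≡⇒y≡ (val (σ ωᴼ)) ⟨ 0ℚ , ι s ⟩ z≡) ⟩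
          fromℤ m *ᴷ 1K +ᴷ fromℤ n *ᴷ ⟨ ½ , ½ ℚ.* ι s ⟩     ≡⟨ twist-combination s m n ⟩
          twist s (fromℤ m +ᴷ fromℤ n *ᴷ ωᴷ)                ≡⟨ cong (twist s) x≡ ⟨
          twist s (val x)                                   ∎

        σω-sign : ∃[ s ] IsSign s × 2y-1 (val (σ ωᴼ)) ≡ ⟨ 0ℚ , ι s ⟩
        σω-sign = z²≡d⇒±√d (2y-1 (val (σ ωᴼ))) z²≡d

        conclude : (∃[ s ] IsSign s × 2y-1 (val (σ ωᴼ)) ≡ ⟨ 0ℚ , ι s ⟩) →
          ∃[ s ] IsSign s × ∀ x → val (σ x) ≡ twist s (val x)
        conclude (s , sign , z≡) = s , sign , λ x → twisted {s} z≡ x (1,ω-span x)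

  -- The difference of the two twists and its quotient by √d.

  ωᴷ-span : ωᴷ ≡ fromℤ 0ℤ +ᴷ fromℤ 1ℤ *ᴷ ωᴷ
  ωᴷ-span = sym (trans (𝕂.+-identityˡ (1K *ᴷ ωᴷ)) (𝕂.*-identityˡ ωᴷ))

  sign² : ∀ {s} → IsSign s → fromℤ (- s) *ᴷ fromℤ (- s) ≡ 1K
  sign² {s} sign = trans (sym (fromℤ-* (- s) (- s))) (cong fromℤ (lemma sign))
    where
    lemma : ∀ {s} → IsSign s → - s * - s ≡ 1ℤ
    lemma (inj₁ refl) = refl
    lemma (inj₂ refl) = refl

  -- Both twists keep the rational part, while the √d-part n/2 is multiplied by `- s` and by `s`,
  -- which differ by -2s.
  twist-difference : ∀ s m n → let z = fromℤ m +ᴷ fromℤ n *ᴷ ωᴷ in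
    twist (- s) z +ᴷ -ᴷ twist s z ≡ fromℤ n *ᴷ (fromℤ (- s) *ᴷ √d)
  twist-difference s m n = cong₂ ⟨_,_⟩
    (S.solve 4 (λ δ s m n → (m :+ (n :* con ½ :+ δ :* (con 0ℚ :* con ½))) :+ (:- (m :+ (n :* con ½ :+ δ :* (con 0ℚ :* con ½))))
       := n :* (s :* con 0ℚ :+ δ :* (con 0ℚ :* con 1ℚ)) :+ δ :* (con 0ℚ :* (s :* con 1ℚ :+ con 0ℚ :* con 0ℚ)))
       refl (ι d) (ι (- s)) (ι m) (ι n))
    (difference (ι (- s)) (ι s) (ι-neg s))
    where
    -- Generalising `ι (- s)` to a variable lets it be replaced by `ℚ.- r`, so that the ring solver
    -- sees the two signs as opposite.
    difference : ∀ q r → q ≡ ℚ.- r → let b = 0ℚ ℚ.+ (ι n ℚ.* ½ ℚ.+ 0ℚ ℚ.* ½) in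
      q ℚ.* b ℚ.+ ℚ.- (r ℚ.* b) ≡ ι n ℚ.* (q ℚ.* 1ℚ ℚ.+ 0ℚ ℚ.* 0ℚ) ℚ.+ 0ℚ ℚ.* (q ℚ.* 0ℚ ℚ.+ ι d ℚ.* (0ℚ ℚ.* 1ℚ))
    difference _ r refl = S.solve 3 (λ δ r n →
         (:- r) :* (con 0ℚ :+ (n :* con ½ :+ con 0ℚ :* con ½)) :+ (:- (r :* (con 0ℚ :+ (n :* con ½ :+ con 0ℚ :* con ½))))
      := n :* ((:- r) :* con 1ℚ :+ con 0ℚ :* con 0ℚ) :+ con 0ℚ :* ((:- r) :* con 0ℚ :+ δ :* (con 0ℚ :* con 1ℚ)))
      refl (ι d) r (ι n)

  -- For x = m + nω this is n; up to the factor ±√d it is τ - σ, whence the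
  -- Leibniz rule 2im-*.
  2im : K → K
  2im z = ⟨ im z ℚ.+ im z , 0ℚ ⟩

  2im-span : ∀ m n → 2im (fromℤ m +ᴷ fromℤ n *ᴷ ωᴷ) ≡ fromℤ n
  2im-span m n = cong₂ ⟨_,_⟩
    (S.solve 1 (λ n → (con 0ℚ :+ (n :* con ½ :+ con 0ℚ :* con ½)) :+ (con 0ℚ :+ (n :* con ½ :+ con 0ℚ :* con ½))
         := n)
         refl (ι n))
    refl

  2im-+ : ∀ y z → 2im (y +ᴷ z) ≡ 2im y +ᴷ 2im z
  2im-+ y z = cong₂ ⟨_,_⟩
    (S.solve 2 (λ b c → (b :+ c) :+ (b :+ c) := (b :+ b) :+ (c :+ c)) refl (im y) (im z)) refl

  2im-neg : ∀ z → 2im (-ᴷ z) ≡ -ᴷ 2im z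
  2im-neg z = cong₂ ⟨_,_⟩ (S.solve 1 (λ b → (:- b) :+ (:- b) := :- (b :+ b)) refl (im z)) refl

  2im-scale : ∀ n z → 2im (fromℤ n *ᴷ z) ≡ fromℤ n *ᴷ 2im z
  2im-scale n z = cong₂ ⟨_,_⟩
    (S.solve 4 (λ δ n a b → (n :* b :+ con 0ℚ :* a) :+ (n :* b :+ con 0ℚ :* a)
         := n :* (b :+ b) :+ δ :* (con 0ℚ :* con 0ℚ))
         refl (ι d) (ι n) (re z) (im z))
    (S.solve 2 (λ n b → con 0ℚ := n :* con 0ℚ :+ con 0ℚ :* (b :+ b)) refl (ι n) (im z))

  2im-* : ∀ s y z → 2im (y *ᴷ z) ≡ 2im y *ᴷ twist (- s) z +ᴷ twist s y *ᴷ 2im z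
  2im-* s y z = leibniz (ι (- s)) (ι s) (ι-neg s)
    where
    leibniz : ∀ q r → q ≡ ℚ.- r → 2im (y *ᴷ z) ≡ 2im y *ᴷ ⟨ re z , q ℚ.* im z ⟩ +ᴷ ⟨ re y , r ℚ.* im y ⟩ *ᴷ 2im z
    leibniz _ r refl = cong₂ ⟨_,_⟩
      (S.solve 6 (λ δ r a b a′ b′ → (a :* b′ :+ b :* a′) :+ (a :* b′ :+ b :* a′)
        := ((b :+ b) :* a′ :+ δ :* (con 0ℚ :* ((:- r) :* b′))) :+ (a :* (b′ :+ b′) :+ δ :* (r :* b :* con 0ℚ)))
        refl (ι d) r (re y) (im y) (re z) (im z))
      (S.solve 5 (λ r a b a′ b′ → con 0ℚ
        := ((b :+ b) :* ((:- r) :* b′) :+ con 0ℚ :* a′) :+ (a :* con 0ℚ :+ r :* b :* (b′ :+ b′)))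
        refl r (re y) (im y) (re z) (im z))

  -- Multiples of √d in coordinates.

  ι-2a+b : ∀ a b → ι (+ 2 * a + b) ≡ ι (+ 2) ℚ.* ι a ℚ.+ ι b
  ι-2a+b a b = trans (ι-+ (+ 2 * a) b) (cong (ℚ._+ ι b) (ι-* (+ 2) a))

  ι-2m+n : ∀ m n → ι (m * + 2 + n) ≡ ι m ℚ.* ι (+ 2) ℚ.+ ι n
  ι-2m+n m n = trans (ι-+ (m * + 2) n) (cong (ℚ._+ ι n) (ι-* m (+ 2)))

  -- The two equations compare twice the rational part and twice the √d-part; doubling clears the
  -- halves in ω.
  multiple-of-√d⇒witness : ∀ c₀ c₁ m n →
    fromℤ c₀ +ᴷ fromℤ c₁ *ᴷ ωᴷ ≡ (fromℤ m +ᴷ fromℤ n *ᴷ ωᴷ) *ᴷ √d → DivisibilityWitness d c₀ c₁ m n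
  multiple-of-√d⇒witness c₀ c₁ m n eq =
      ι-injective (begin
        ι (+ 2 * c₀ + c₁)   ≡⟨ ι-2a+b c₀ c₁ ⟩
        ι (+ 2) ℚ.* ι c₀ ℚ.+ ι c₁
          ≡⟨ S.solve 3 (λ δ a b → con (ι (+ 2)) :* a :+ b
               := con (ι (+ 2)) :* (a :+ (b :* con ½ :+ δ :* (con 0ℚ :* con ½))))
               refl (ι d) (ι c₀) (ι c₁) ⟩
        ι (+ 2) ℚ.* re (fromℤ c₀ +ᴷ fromℤ c₁ *ᴷ ωᴷ)
          ≡⟨ cong (λ z → ι (+ 2) ℚ.* re z) eq ⟩
        ι (+ 2) ℚ.* re ((fromℤ m +ᴷ fromℤ n *ᴷ ωᴷ) *ᴷ √d)
          ≡⟨ S.solve 3 (λ δ m n → con (ι (+ 2)) :* ((m :+ (n :* con ½ :+ δ :* (con 0ℚ :* con ½))) :* con 0ℚ :+ δ :* ((con 0ℚ :+ (n :* con ½ :+ con 0ℚ :* con ½)) :* con 1ℚ))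
               := n :* δ)
               refl (ι d) (ι m) (ι n) ⟩
        ι n ℚ.* ι d         ≡⟨ ι-* n d ⟨
        ι (n * d)           ∎)
    , ι-injective (begin
        ι c₁
          ≡⟨ S.solve 1 (λ b → b := con (ι (+ 2)) :* (con 0ℚ :+ (b :* con ½ :+ con 0ℚ :* con ½))) refl (ι c₁) ⟩
        ι (+ 2) ℚ.* im (fromℤ c₀ +ᴷ fromℤ c₁ *ᴷ ωᴷ)
          ≡⟨ cong (λ z → ι (+ 2) ℚ.* im z) eq ⟩
        ι (+ 2) ℚ.* im ((fromℤ m +ᴷ fromℤ n *ᴷ ωᴷ) *ᴷ √d)
          ≡⟨ S.solve 3 (λ δ m n → con (ι (+ 2)) :* ((m :+ (n :* con ½ :+ δ :* (con 0ℚ :* con ½))) :* con 1ℚ :+ (con 0ℚ :+ (n :* con ½ :+ con 0ℚ :* con ½)) :* con 0ℚ)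
               := m :* con (ι (+ 2)) :+ n)
               refl (ι d) (ι m) (ι n) ⟩
        ι m ℚ.* ι (+ 2) ℚ.+ ι n   ≡⟨ ι-2m+n m n ⟨
        ι (m * + 2 + n)           ∎)

  witness⇒multiple-of-√d : ∀ c₀ c₁ m n → DivisibilityWitness d c₀ c₁ m n →
    fromℤ c₀ +ᴷ fromℤ c₁ *ᴷ ωᴷ ≡ (fromℤ m +ᴷ fromℤ n *ᴷ ωᴷ) *ᴷ √d
  witness⇒multiple-of-√d c₀ c₁ m n (2c₀+c₁≡nd , c₁≡2m+n) = cong₂ ⟨_,_⟩
    (begin
      re (fromℤ c₀ +ᴷ fromℤ c₁ *ᴷ ωᴷ)
        ≡⟨ S.solve 3 (λ δ a b → a :+ (b :* con ½ :+ δ :* (con 0ℚ :* con ½))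
             := con ½ :* (con (ι (+ 2)) :* a :+ b))
             refl (ι d) (ι c₀) (ι c₁) ⟩
      ½ ℚ.* (ι (+ 2) ℚ.* ι c₀ ℚ.+ ι c₁)
        ≡⟨ cong (½ ℚ.*_) (trans (sym (ι-2a+b c₀ c₁)) (trans (cong ι 2c₀+c₁≡nd) (ι-* n d))) ⟩
      ½ ℚ.* (ι n ℚ.* ι d)
        ≡⟨ S.solve 3 (λ δ m n → con ½ :* (n :* δ)
             := (m :+ (n :* con ½ :+ δ :* (con 0ℚ :* con ½))) :* con 0ℚ :+ δ :* ((con 0ℚ :+ (n :* con ½ :+ con 0ℚ :* con ½)) :* con 1ℚ))
             refl (ι d) (ι m) (ι n) ⟩
      re ((fromℤ m +ᴷ fromℤ n *ᴷ ωᴷ) *ᴷ √d) ∎)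
    (begin
      im (fromℤ c₀ +ᴷ fromℤ c₁ *ᴷ ωᴷ)
        ≡⟨ S.solve 1 (λ b → con 0ℚ :+ (b :* con ½ :+ con 0ℚ :* con ½) := con ½ :* b) refl (ι c₁) ⟩
      ½ ℚ.* ι c₁
        ≡⟨ cong (½ ℚ.*_) (trans (cong ι c₁≡2m+n) (ι-2m+n m n)) ⟩
      ½ ℚ.* (ι m ℚ.* ι (+ 2) ℚ.+ ι n)
        ≡⟨ S.solve 3 (λ δ m n → con ½ :* (m :* con (ι (+ 2)) :+ n)
             := (m :+ (n :* con ½ :+ δ :* (con 0ℚ :* con ½))) :* con 1ℚ :+ (con 0ℚ :+ (n :* con ½ :+ con 0ℚ :* con ½)) :* con 0ℚ)
             refl (ι d) (ι m) (ι n) ⟩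
      im ((fromℤ m +ᴷ fromℤ n *ᴷ ωᴷ) *ᴷ √d) ∎)

  half[d-1] : (d - 1ℤ) / + 2 * + 2 + 1ℤ ≡ d
  half[d-1] = trans
    (cong (_+ 1ℤ) (n∣a⇒[a/n]*n≡a (d - 1ℤ) (+ 2) (ℕ.∣-trans (ℕ.divides 2 refl) 4∣d-1)))
    (sym (i≡i-1+1 d))

  -- Only ±1 divide 1. The value 1 is excluded, and -1 would make 4 divide -2.
  d∤1 : ¬ d ∣ 1ℤ
  d∤1 d∣1 = ∣d∣≢1 d d≢1 4∣d-1 (ℕ.∣1⇒≡1 d∣1)
    where
    ∣d∣≢1 : ∀ d → d ≢ 1ℤ → + 4 ∣ d - 1ℤ → ℤ.∣ d ∣ ≢ 1
    ∣d∣≢1 (+ .1)       1≢1 _   refl = 1≢1 refl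
    ∣d∣≢1 ℤ.-[1+ .0 ]  _   4∣2 refl = contradiction 4∣2 (ℕ.>⇒∤ (ℕ.s≤s (ℕ.s≤s (ℕ.s≤s ℕ.z≤n))))

  -- Inner derivations and an outer one.

  module _ (σ τ : O → O) (s : ℤ) (sign : IsSign s)
    (σ≡ : ∀ x → val (σ x) ≡ twist s (val x)) (τ≡ : ∀ x → val (τ x) ≡ twist (- s) (val x)) where

    -- By commutativity the inner derivation of `g` is multiplication of τ(x) - σ(x) by `g`, and
    -- this difference is -s·n√d.
    inner-span : ∀ g x m n → val x ≡ fromℤ m +ᴷ fromℤ n *ᴷ ωᴷ →
      g *ᴷ val (τ x) +ᴷ -ᴷ (val (σ x) *ᴷ g) ≡ fromℤ n *ᴷ (fromℤ (- s) *ᴷ g *ᴷ √d)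
    inner-span g x m n x≡ = begin
      g *ᴷ val (τ x) +ᴷ -ᴷ (val (σ x) *ᴷ g)
        ≡⟨ solveᴷ 3 (λ g t s → g :*ᴷ t :+ᴷ (:-ᴷ (s :*ᴷ g))
             :=ᴷ (t :+ᴷ (:-ᴷ s)) :*ᴷ g)
             refl g (val (τ x)) (val (σ x)) ⟩
      (val (τ x) +ᴷ -ᴷ val (σ x)) *ᴷ g
        ≡⟨ cong (_*ᴷ g) (cong₂ (λ t s → t +ᴷ -ᴷ s) (trans (τ≡ x) (cong (twist (- s)) x≡)) (trans (σ≡ x) (cong (twist s) x≡))) ⟩
      (twist (- s) (fromℤ m +ᴷ fromℤ n *ᴷ ωᴷ) +ᴷ -ᴷ twist s (fromℤ m +ᴷ fromℤ n *ᴷ ωᴷ)) *ᴷ g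
        ≡⟨ cong (_*ᴷ g) (twist-difference s m n) ⟩
      fromℤ n *ᴷ (fromℤ (- s) *ᴷ √d) *ᴷ g
        ≡⟨ solveᴷ 4 (λ n s r g → n :*ᴷ (s :*ᴷ r) :*ᴷ g
             :=ᴷ n :*ᴷ (s :*ᴷ g :*ᴷ r))
             refl (fromℤ n) (fromℤ (- s)) √d g ⟩
      fromℤ n *ᴷ (fromℤ (- s) *ᴷ g *ᴷ √d) ∎

    module _ (D : Derivation σ τ) where

      open Derivation D

      D-additive : IsAdditive ⟦_⟧
      D-additive x y z z≡ = trans (⟦⟧-cong {z} {x ⊕ y} z≡) (+-homo x y)

      D-homogeneous : IsHomogeneous ⟦_⟧
      D-homogeneous n x z z≡ = trans (⟦⟧-cong {z} {int n ⊗ x} z≡) (*ₗ-homo n x)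

      D-leibniz : ∀ x y z → val z ≡ val x *ᴷ val y → val ⟦ z ⟧ ≡ val ⟦ x ⟧ *ᴷ val (τ y) +ᴷ val (σ x) *ᴷ val ⟦ y ⟧
      D-leibniz x y z z≡ = trans (⟦⟧-cong {z} {x ⊗ y} z≡) (leibniz x y)

      -- Both σ and τ fix 1, so the Leibniz rule for 1 · 1 reads D(1) = D(1) + D(1).
      D1≡0 : val ⟦ 1ᴼ ⟧ ≡ 0K
      D1≡0 = begin
        D1                    ≡⟨ solveᴷ 1 (λ y → y :=ᴷ (y :*ᴷ conᴷ 1ℤ :+ᴷ conᴷ 1ℤ :*ᴷ y) :+ᴷ (:-ᴷ y)) refl D1 ⟩
        (D1 *ᴷ 1K +ᴷ 1K *ᴷ D1) +ᴷ -ᴷ D1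
          ≡⟨ cong₂ (λ t s → (D1 *ᴷ t +ᴷ s *ᴷ D1) +ᴷ -ᴷ D1) (trans (τ≡ 1ᴼ) (twist-1 (- s))) (trans (σ≡ 1ᴼ) (twist-1 s)) ⟨
        (D1 *ᴷ val (τ 1ᴼ) +ᴷ val (σ 1ᴼ) *ᴷ D1) +ᴷ -ᴷ D1
          ≡⟨ cong (_+ᴷ -ᴷ D1) (D-leibniz 1ᴼ 1ᴼ 1ᴼ (sym (𝕂.*-identityʳ 1K))) ⟨
        D1 +ᴷ -ᴷ D1           ≡⟨ 𝕂.-‿inverseʳ D1 ⟩
        0K                    ∎
        where D1 = val ⟦ 1ᴼ ⟧

      D-span : ∀ x m n → val x ≡ fromℤ m +ᴷ fromℤ n *ᴷ ωᴷ → val ⟦ x ⟧ ≡ fromℤ n *ᴷ val ⟦ ωᴼ ⟧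
      D-span x m n x≡ = begin
        val ⟦ x ⟧                                        ≡⟨ linear-on-span {⟦_⟧} D-additive D-homogeneous x m n x≡ ⟩
        fromℤ m *ᴷ val ⟦ 1ᴼ ⟧ +ᴷ fromℤ n *ᴷ val ⟦ ωᴼ ⟧   ≡⟨ cong (λ y → fromℤ m *ᴷ y +ᴷ fromℤ n *ᴷ val ⟦ ωᴼ ⟧) D1≡0 ⟩
        fromℤ m *ᴷ 0K +ᴷ fromℤ n *ᴷ val ⟦ ωᴼ ⟧           ≡⟨ cong (_+ᴷ fromℤ n *ᴷ val ⟦ ωᴼ ⟧) (𝕂.zeroʳ (fromℤ m)) ⟩
        0K +ᴷ fromℤ n *ᴷ val ⟦ ωᴼ ⟧                      ≡⟨ 𝕂.+-identityˡ (fromℤ n *ᴷ val ⟦ ωᴼ ⟧) ⟩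
        fromℤ n *ᴷ val ⟦ ωᴼ ⟧                            ∎

      inner⇒√d∣Dω : IsInner D → ∃[ β ] val ⟦ ωᴼ ⟧ ≡ val β *ᴷ √d
      inner⇒√d∣Dω (β , inner) = scale (- s) β , (begin
        val ⟦ ωᴼ ⟧                                       ≡⟨ inner-val ωᴼ ⟩
        val β *ᴷ val (τ ωᴼ) +ᴷ -ᴷ (val (σ ωᴼ) *ᴷ val β)  ≡⟨ inner-span (val β) ωᴼ 0ℤ 1ℤ ωᴷ-span ⟩
        1K *ᴷ (fromℤ (- s) *ᴷ val β *ᴷ √d)               ≡⟨ 𝕂.*-identityˡ (fromℤ (- s) *ᴷ val β *ᴷ √d) ⟩
        fromℤ (- s) *ᴷ val β *ᴷ √d                       ∎)
        where
        inner-val : ∀ x → val ⟦ x ⟧ ≡ val β *ᴷ val (τ x) +ᴷ -ᴷ (val (σ x) *ᴷ val β)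
        inner-val x = inner x

      √d∣Dω⇒inner : ∀ β → val ⟦ ωᴼ ⟧ ≡ val β *ᴷ √d → IsInner D
      -- The factor `- s` meets the one produced by `inner-span`, and their product is 1.
      √d∣Dω⇒inner β Dω≡ = scale (- s) β , λ x → inner x (1,ω-span x)
        where
        inner : ∀ x → (∃[ m ] ∃[ n ] val x ≡ fromℤ m +ᴷ fromℤ n *ᴷ ωᴷ) →
          val ⟦ x ⟧ ≡ (fromℤ (- s) *ᴷ val β) *ᴷ val (τ x) +ᴷ -ᴷ (val (σ x) *ᴷ (fromℤ (- s) *ᴷ val β))
        inner x (m , n , x≡) = begin
          val ⟦ x ⟧                          ≡⟨ D-span x m n x≡ ⟩
          fromℤ n *ᴷ val ⟦ ωᴼ ⟧              ≡⟨ cong (fromℤ n *ᴷ_) Dω≡ ⟩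
          fromℤ n *ᴷ (val β *ᴷ √d)           ≡⟨ cong (λ y → fromℤ n *ᴷ (y *ᴷ √d)) (𝕂.*-identityˡ (val β)) ⟨
          fromℤ n *ᴷ (1K *ᴷ val β *ᴷ √d)     ≡⟨ cong (λ y → fromℤ n *ᴷ (y *ᴷ val β *ᴷ √d)) (sign² sign) ⟨
          fromℤ n *ᴷ (fromℤ (- s) *ᴷ fromℤ (- s) *ᴷ val β *ᴷ √d)
            ≡⟨ cong (λ y → fromℤ n *ᴷ (y *ᴷ √d)) (𝕂.*-assoc (fromℤ (- s)) (fromℤ (- s)) (val β)) ⟩
          fromℤ n *ᴷ (fromℤ (- s) *ᴷ (fromℤ (- s) *ᴷ val β) *ᴷ √d)
            ≡⟨ inner-span (fromℤ (- s) *ᴷ val β) x m n x≡ ⟨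
          (fromℤ (- s) *ᴷ val β) *ᴷ val (τ x) +ᴷ -ᴷ (val (σ x) *ᴷ (fromℤ (- s) *ᴷ val β)) ∎

    -- On m + nω this is nω. Using `2im` instead of chosen coordinates reduces linearity and the
    -- Leibniz rule to identities in `K`.
    outer-val : K → K
    outer-val z = 2im z *ᴷ ωᴷ

    outer-integral : ∀ x → IsAlgebraicInteger (outer-val (val x))
    outer-integral x = integral (1,ω-span x)
      where
      integral : (∃[ m ] ∃[ n ] val x ≡ fromℤ m +ᴷ fromℤ n *ᴷ ωᴷ) → IsAlgebraicInteger (outer-val (val x))
      integral (m , n , x≡) = isAlgebraicInteger-*
        (subst IsAlgebraicInteger (trans (sym (2im-span m n)) (cong 2im (sym x≡))) (isAlgebraicInteger-fromℤ n))
        (isInteger ωᴼ)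

    outer : Derivation σ τ
    outer = record
      { ⟦_⟧ = λ x → outer-val (val x) ⊣ outer-integral x
      ; isLinear = record
        { +ᴹ-isGroupHomomorphism = record
          { isMonoidHomomorphism = record
            { isMagmaHomomorphism = record
              { isRelHomomorphism = record { cong = cong outer-val }
              ; homo = λ x y → trans (cong (_*ᴷ ωᴷ) (2im-+ (val x) (val y))) (𝕂.distribʳ ωᴷ (2im (val x)) (2im (val y)))
              }
            ; ε-homo = 𝕂.zeroˡ ωᴷ
            }
          ; ⁻¹-homo = λ x → trans (cong (_*ᴷ ωᴷ) (2im-neg (val x)))
              (solveᴷ 2 (λ y w → (:-ᴷ y) :*ᴷ w :=ᴷ :-ᴷ (y :*ᴷ w)) refl (2im (val x)) ωᴷ)
          }
        ; *ₗ-homo = λ n x → trans (cong (_*ᴷ ωᴷ) (2im-scale n (val x))) (𝕂.*-assoc (fromℤ n) (2im (val x)) ωᴷ)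
        }
      ; leibniz = λ x y → begin
          2im (val x *ᴷ val y) *ᴷ ωᴷ
            ≡⟨ cong (_*ᴷ ωᴷ) (2im-* s (val x) (val y)) ⟩
          (2im (val x) *ᴷ twist (- s) (val y) +ᴷ twist s (val x) *ᴷ 2im (val y)) *ᴷ ωᴷ
            ≡⟨ cong₂ (λ t s → (2im (val x) *ᴷ t +ᴷ s *ᴷ 2im (val y)) *ᴷ ωᴷ) (τ≡ y) (σ≡ x) ⟨
          (2im (val x) *ᴷ val (τ y) +ᴷ val (σ x) *ᴷ 2im (val y)) *ᴷ ωᴷ
            ≡⟨ solveᴷ 5 (λ a t s b w → (a :*ᴷ t :+ᴷ s :*ᴷ b) :*ᴷ w :=ᴷ a :*ᴷ w :*ᴷ t :+ᴷ s :*ᴷ (b :*ᴷ w))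
                 refl (2im (val x)) (val (τ y)) (val (σ x)) (2im (val y)) ωᴷ ⟩
          2im (val x) *ᴷ ωᴷ *ᴷ val (τ y) +ᴷ val (σ x) *ᴷ (2im (val y) *ᴷ ωᴷ) ∎
      }

    module _ (D : Derivation σ τ) (c₀ c₁ : ℤ)
      (Dω≡ : val (Derivation.⟦_⟧ D ωᴼ) ≡ fromℤ c₀ +ᴷ fromℤ c₁ *ᴷ ωᴷ) where

      inner⇒divisible : IsInner D → d ∣ - c₀ + c₁ * ((d - 1ℤ) / + 2) × d ∣ + 2 * c₀ + c₁
      inner⇒divisible inner = divisible (inner⇒√d∣Dω D inner)
        where
        spanned : ∀ β → (∃[ m ] ∃[ n ] val β ≡ fromℤ m +ᴷ fromℤ n *ᴷ ωᴷ) → val (Derivation.⟦_⟧ D ωᴼ) ≡ val β *ᴷ √d →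
          d ∣ - c₀ + c₁ * ((d - 1ℤ) / + 2) × d ∣ + 2 * c₀ + c₁
        spanned β (m , n , β≡) Dω≡β√d = witness⇒divisible d ((d - 1ℤ) / + 2) c₀ c₁ m n half[d-1]
          (multiple-of-√d⇒witness c₀ c₁ m n (trans (sym Dω≡) (trans Dω≡β√d (cong (_*ᴷ √d) β≡))))

        divisible : (∃[ β ] val (Derivation.⟦_⟧ D ωᴼ) ≡ val β *ᴷ √d) →
          d ∣ - c₀ + c₁ * ((d - 1ℤ) / + 2) × d ∣ + 2 * c₀ + c₁
        divisible (β , Dω≡β√d) = spanned β (1,ω-span β) Dω≡β√d

      divisible⇒inner : d ∣ - c₀ + c₁ * ((d - 1ℤ) / + 2) → d ∣ + 2 * c₀ + c₁ → IsInner D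
      divisible⇒inner d∣a d∣b = inner (divisible⇒witness d ((d - 1ℤ) / + 2) c₀ c₁ d≢0 half[d-1] d∣a d∣b)
        where
        inner : (∃[ m ] ∃[ n ] DivisibilityWitness d c₀ c₁ m n) → IsInner D
        inner (m , n , witness) = √d∣Dω⇒inner D (int m ⊕ scale n ωᴼ)
          (trans Dω≡ (witness⇒multiple-of-√d c₀ c₁ m n witness))

      inner⇔divisible : IsInner D ⇔ (d ∣ - c₀ + c₁ * ((d - 1ℤ) / + 2) × d ∣ + 2 * c₀ + c₁)
      inner⇔divisible = mk⇔ inner⇒divisible λ (d∣a , d∣b) → divisible⇒inner d∣a d∣b

      ∣c₀∣c₁⇒inner : d ∣ c₀ → d ∣ c₁ → IsInner D
      ∣c₀∣c₁⇒inner d∣c₀ d∣c₁ =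
        let (d∣a , d∣b) = ∣c₀∣c₁⇒divisible d ((d - 1ℤ) / + 2) c₀ c₁ d∣c₀ d∣c₁
        in divisible⇒inner d∣a d∣b

    -- For c₀ = 0 and c₁ = 1 the second condition is that `d` divides 1. The derivation is kept
    -- general because being non-zero in `Out` concerns `outer +ᴹ -ᴹ 0ᴹ`, not `outer` itself.
    outer-notInner : ∀ (D : Derivation σ τ) → val (Derivation.⟦_⟧ D ωᴼ) ≡ ωᴷ → ¬ IsInner D
    outer-notInner D Dω≡ω inner = d∤1 (proj₂ (inner⇒divisible D 0ℤ 1ℤ (trans Dω≡ω ωᴷ-span) inner))

    Out-nonTrivial : NonTrivial (Out σ τ)
    Out-nonTrivial = outer , outer-notInner (outer +ᴹ -ᴹ 0ᴹ)
      -- `2im ωᴷ` computes to `1K`, and the subtracted zero derivation contributes the `0K` removed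
      -- here.
      (trans (𝕂.+-identityʳ (1K *ᴷ ωᴷ)) (𝕂.*-identityˡ ωᴷ))
      where open LeftModule (Der σ τ) using (_+ᴹ_; -ᴹ_; 0ᴹ)

  -- From two distinct endomorphisms to opposite signs, and the conclusion.

  opposite-signs : ∀ (σ τ : O → O) {s t} → ¬ (∀ x → σ x ≈ τ x) → IsSign s → IsSign t →
    (∀ x → val (σ x) ≡ twist s (val x)) → (∀ x → val (τ x) ≡ twist t (val x)) → t ≡ - s
  opposite-signs σ τ σ≉τ (inj₁ refl) (inj₁ refl) σ≡ τ≡ = contradiction (λ x → trans (σ≡ x) (sym (τ≡ x))) σ≉τ
  opposite-signs σ τ σ≉τ (inj₁ refl) (inj₂ refl) σ≡ τ≡ = refl
  opposite-signs σ τ σ≉τ (inj₂ refl) (inj₁ refl) σ≡ τ≡ = refl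
  opposite-signs σ τ σ≉τ (inj₂ refl) (inj₂ refl) σ≡ τ≡ = contradiction (λ x → trans (σ≡ x) (sym (τ≡ x))) σ≉τ

  Conclusion : (σ τ : O → O) → Set
  Conclusion σ τ =
    (∀ (D : Derivation σ τ) (c₀ c₁ : ℤ) →
       val (Derivation.⟦_⟧ D ωᴼ) ≡ fromℤ c₀ +ᴷ fromℤ c₁ *ᴷ ωᴷ →
       (IsInner D ⇔ (d ∣ - c₀ + c₁ * ((d - 1ℤ) / + 2) × d ∣ + 2 * c₀ + c₁))
       × (d ∣ c₀ → d ∣ c₁ → IsInner D))
    × NonTrivial (Out σ τ)

  twists⇒conclusion : ∀ σ τ → ¬ (∀ x → σ x ≈ τ x) →
    (∃[ s ] IsSign s × ∀ x → val (σ x) ≡ twist s (val x)) →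
    (∃[ t ] IsSign t × ∀ x → val (τ x) ≡ twist t (val x)) → Conclusion σ τ
  twists⇒conclusion σ τ σ≉τ (s , sign-s , σ≡) (t , sign-t , τ≡) =
      (λ D c₀ c₁ Dω≡ → inner⇔divisible σ τ s sign-s σ≡ τ≡′ D c₀ c₁ Dω≡
                  , ∣c₀∣c₁⇒inner σ τ s sign-s σ≡ τ≡′ D c₀ c₁ Dω≡)
    , Out-nonTrivial σ τ s sign-s σ≡ τ≡′
    where
    τ≡′ : ∀ x → val (τ x) ≡ twist (- s) (val x)
    τ≡′ = subst (λ t → ∀ x → val (τ x) ≡ twist t (val x)) (opposite-signs σ τ σ≉τ sign-s sign-t σ≡ τ≡) τ≡

theorem3p5 : ∀ (d : ℤ) → SquareFree d → (d≡1[4] : + 4 ∣ d - 1ℤ) → d ≢ 1ℤ →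
    let open RingOfIntegers d in
    ∀ (σ τ : O → O) →
    IsEndomorphism σ → ¬ (∀ x → σ x ≈ 0#) →
    IsEndomorphism τ → ¬ (∀ x → τ x ≈ 0#) →
    ¬ (∀ x → σ x ≈ τ x) →
    (∀ (D : Derivation σ τ) (c₀ c₁ : ℤ) →
    Derivation.⟦ D ⟧ (ω d≡1[4]) ≈ int c₀ ⊕ int c₁ ⊗ ω d≡1[4] →
    (IsInner D ⇔ (d ∣ - c₀ + c₁ * ((d - 1ℤ) / + 2) × d ∣ + 2 * c₀ + c₁))
    × (d ∣ c₀ → d ∣ c₁ → IsInner D))
    × NonTrivial (Out σ τ)
theorem3p5 d sf d≡1[4] d≢1 σ τ σ-hom σ≉0 τ-hom τ≉0 σ≉τ = twists⇒conclusion σ τ σ≉τ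
  (nonzero-endomorphism⇒twist σ σ-hom σ≉0) (nonzero-endomorphism⇒twist τ τ-hom τ≉0)
  where open QuadraticIntegers d sf d≡1[4] d≢1
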